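{- Let $G$ be a nontrivial finite Abelian group. If $G\cong\mathbb{Z}_4$, then $\mathcal{L}(G)$ is not well-rounded; for every other nontrivial finite Abelian group $G$, the lattice $\mathcal{L}(G)$ is well-rounded. Moreover, the minimum distance satisfies $d(\mathbb{Z}_2)=\sqrt{8}$, $d(\mathbb{Z}_3)=\sqrt{6}$, and $d(G)=2$ for every finite Abelian group $G$ not isomorphic to the trivial group, $\mathbb{Z}_2$ or $\mathbb{Z}_3$.
   Context: Let $G=\{0,g_1,\dots,g_n\}$ be a finite Abelian (additive) group of order $n+1$, with its nonzero elements listed as $g_1,\dots,g_n$. Define the lattice $$\mathcal{L}(G)=\Big\{X=(x_1,\dots,x_n,-x_1-\cdots-x_n)\in\mathbb{Z}^{n+1}:\ x_1g_1+\cdots+x_ng_n=0\Big\},$$ a sublattice of full rank $n$ of the root lattice $\mathcal{A}_n=\{(x_1,\dots,x_n,-x_1-\cdots-x_n)\in\mathbb{Z}^{n+1}\}$ (changing the listing of the $g_i$ only permutes coordinates). Let $\|\cdot\|$ be the Euclidean norm, $d(G)=\min\{\|X\|: X\in\mathcal{L}(G)\setminus\{0\}\}$ the minimum distance, and $\mathcal{S}(G)$ the set of $X\in\mathcal{L}(G)$ with $\|X\|=d(G)$ (minimal vectors). The lattice $\mathcal{L}(G)$ is called well-rounded if $\mathcal{S}(G)$ contains $n$ linearly independent vectors. $\mathbb{Z}_m$ denotes the cyclic group of order $m$. -}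

module Defs where

open import Level using (Level)
open import Algebra.Bundles using (AbelianGroup)
open import Data.Nat as ℕ using (ℕ; zero; suc; NonZero)
open import Data.Nat.DivMod using (_%_; m%n<n)
open import Data.Fin as Fin using (Fin; zero; suc; toℕ; fromℕ<; inject₁; fromℕ)
open import Data.Integer as ℤ using (ℤ; +_; 0ℤ; -_)
open import Data.Product using (Σ; ∃; _×_)
open import Relation.Binary.PropositionalEquality using (_≡_)
open import Relation.Nullary using (¬_)

∑ℤ : (n : ℕ) → (Fin n → ℤ) → ℤ
∑ℤ zero    f = 0ℤ
∑ℤ (suc n) f = f zero ℤ.+ ∑ℤ n (λ i → f (suc i))

normSq : (m : ℕ) → (Fin m → ℤ) → ℤ
normSq m X = ∑ℤ m (λ i → X i ℤ.* X i)

NonZeroVec : (m : ℕ) → (Fin m → ℤ) → Set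
NonZeroVec m X = ¬ (∀ i → X i ≡ 0ℤ)

_⊕[_]_ : (a : ℕ) → (m : ℕ) → .{{NonZero m}} → ℕ → Fin m
a ⊕[ m ] b = fromℕ< (m%n<n (a ℕ.+ b) m)

addMod : (m : ℕ) → .{{NonZero m}} → Fin m → Fin m → Fin m
addMod m a b = toℕ a ⊕[ m ] toℕ b

module _ {c ℓ : Level} (G : AbelianGroup c ℓ) where
  open AbelianGroup G

  natMul : ℕ → Carrier → Carrier
  natMul zero    g = ε
  natMul (suc k) g = g ∙ natMul k g

  intMul : ℤ → Carrier → Carrier
  intMul (+ k)      g = natMul k g
  intMul ℤ.-[1+ k ] g = (natMul (suc k) g) ⁻¹

  ∑G : (n : ℕ) → (Fin n → Carrier) → Carrier
  ∑G zero    f = ε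
  ∑G (suc n) f = f zero ∙ ∑G n (λ i → f (suc i))

  IsoCyclic : (m : ℕ) → .{{NonZero m}} → Set (c Level.⊔ ℓ)
  IsoCyclic m = Σ (Fin m → Carrier) λ f →
      (∀ a b → f (addMod m a b) ≈ (f a ∙ f b))
    × (∀ a b → f a ≈ f b → a ≡ b)
    × (∀ x → ∃ λ a → f a ≈ x)

  IsListing : (n : ℕ) → (Fin (suc n) → Carrier) → Set (c Level.⊔ ℓ)
  IsListing n e =
      (e zero ≈ ε)
    × (∀ i j → e i ≈ e j → i ≡ j)
    × (∀ x → ∃ λ i → e i ≈ x)

  module _ (n : ℕ) (e : Fin (suc n) → Carrier) where
    g : Fin n → Carrier
    g i = e (suc i)

    InL : (Fin (suc n) → ℤ) → Set ℓ
    InL X = (X (fromℕ n) ≡ - ∑ℤ n (λ i → X (inject₁ i)))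
          × (∑G n (λ i → intMul (X (inject₁ i)) (g i)) ≈ ε)

    MinDistSq : ℤ → Set ℓ
    MinDistSq D =
        (∃ λ X → InL X × NonZeroVec (suc n) X × normSq (suc n) X ≡ D)
      × (∀ X → InL X → NonZeroVec (suc n) X → D ℤ.≤ normSq (suc n) X)

    Minimal : (Fin (suc n) → ℤ) → Set ℓ
    Minimal X = InL X × NonZeroVec (suc n) X
              × (∀ Y → InL Y → NonZeroVec (suc n) Y → normSq (suc n) X ℤ.≤ normSq (suc n) Y)

    -- linear independence of n vectors of ℤ^{n+1}
    -- (over ℤ, equivalently over ℚ or ℝ by clearing denominators)
    LinIndep : (Fin n → Fin (suc n) → ℤ) → Set
    LinIndep v = ∀ (a : Fin n → ℤ) →
      (∀ j → ∑ℤ n (λ k → a k ℤ.* v k j) ≡ 0ℤ) → ∀ k → a k ≡ 0ℤ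

    WellRounded : Set ℓ
    WellRounded = ∃ λ (v : Fin n → Fin (suc n) → ℤ) → (∀ k → Minimal (v k)) × LinIndep v

{-# OPTIONS --safe #-}
module Submission where

-- Index the coordinates by the elements of G. A lattice vector of squared norm below 4 would be a
-- root e_i - e_j, whose weight h i - h j is not 0; and if |G| >= 4 there are a, b with 0, a, b, a + b
-- distinct, so that the parallelogram vector e_0 + e_(a+b) - e_a - e_b attains 4.
--
-- A function φ on G orthogonal to all parallelogram vectors satisfies φ (a + b) + φ 0 = φ a + φ b for
-- generic a, b. If |G| >= 5, choosing auxiliary elements off a few exceptional values extends this to
-- all a, b, so that φ - φ 0 is a homomorphism from a finite group to ℤ, hence 0; if |G| >= 3 and G has
-- exponent 2, every φ a - φ 0 vanishes directly. So as long as fewer than n independent parallelogram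
-- vectors are at hand, a nonzero vector of coordinate sum 0 orthogonal to them is not orthogonal to
-- some further parallelogram vector, which is therefore independent of them.
--
-- The groups left are those of order 2 and 3, handled by explicit vectors, and ℤ/4, whose minimal
-- vectors satisfy x_0 + x_2 = 0 = x_1 + x_3 and so span a space of dimension 2 only.

open import Defs
open import Level using (Level)
open import Algebra.Bundles using (AbelianGroup; CommutativeMonoid)
open import Data.Nat as ℕ using (ℕ; zero; suc; _≥_; NonZero; z≤n; s<s⁻¹)
import Data.Nat.Properties as ℕ
open import Data.Nat.DivMod using (_%_; _/_; m%n<n; m≡m%n+[m/n]*n)
open import Data.Fin using (Fin; zero; suc; toℕ; fromℕ; inject₁; punchIn; punchOut)
open import Data.Fin.Patterns using (0F; 1F; 2F; 3F; 4F)
open import Data.Fin.Permutation as Perm using (Permutation; permutation; _⟨$⟩ʳ_; _⟨$⟩ˡ_)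
open import Data.Fin.Properties
  using (_≟_; any?; all?; punchInᵢ≢i; punchIn-punchOut; suc-injective; injective⇒≤; <⇒notInjective;
         cantor-schröder-bernstein; toℕ<n; toℕ-fromℕ<; toℕ-injective)
open import Data.Fin.Relation.Unary.Top using (view; ‵fromℕ; ‵inject₁)
open import Data.Integer as ℤ using (ℤ; +_; -[1+_]; 0ℤ; 1ℤ; -_; _+_; _*_; _-_; _≤_; _<_; _⊖_)
import Data.Integer.Properties as ℤ
open import Data.Integer.Tactic.RingSolver using (solve-∀)
open import Data.List using (List; []; _∷_; length; lookup)
open import Data.List.Membership.Propositional.Properties using (∈-lookup)
open import Data.List.Relation.Unary.All as All using (All; []; _∷_)
open import Data.List.Relation.Unary.All.Properties using (¬Any⇒All¬)
open import Data.List.Relation.Unary.AllPairs using (AllPairs; []; _∷_)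
open import Data.List.Relation.Unary.Any as Any using (Any; index)
open import Data.List.Relation.Unary.Any.Properties using (lookup-index)
open import Data.Product using (∃; ∃₂; _×_; _,_; proj₁; proj₂)
open import Data.Sum as Sum using (_⊎_; inj₁; inj₂; [_,_]′)
open import Data.Unit using (tt)
import Data.Vec.Functional as Vector
open import Function using (_∘_)
import Relation.Binary.PropositionalEquality as ≡
open ≡ using (_≡_; _≢_; _≗_)
open import Relation.Binary.Definitions using (Decidable)
open import Relation.Nullary using (¬_; Dec; yes; no; contradiction)
open import Relation.Nullary.Decidable
  using (¬?; _×-dec_; _⊎-dec_; _→-dec_; decidable-stable; map′; toWitness)

open import Algebra.Properties.AbelianGroup ℤ.+-0-abelianGroup using ()
  renaming (∙-cancelʳ to +-cancelʳ; inverseʳ-unique to +-inverseʳ-unique)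
open import Algebra.Properties.Semiring.Sum ℤ.+-*-semiring
  using (sum; sum-cong-≗; sum-permute; sum-init-last; sum-replicate-zero; ∑-distrib-+; ∑-comm;
         *-distribˡ-sum; *-distribʳ-sum)

private variable
  c ℓ p : Level
  k m : ℕ

-- Integer vectors, dot products and linear systems.

module _ {c ℓ} (M : CommutativeMonoid c ℓ) where
  open CommutativeMonoid M renaming (trans to ≈-trans)
  open import Algebra.Properties.CommutativeMonoid.Sum M
    using (sum-cong-≋)
    renaming (sum to sumᴹ; sum-remove to sumᴹ-remove; sum-replicate-zero to sumᴹ-replicate-zero)

  sum-supported-at : ∀ a (t : Fin m → Carrier) → (∀ j → j ≢ a → t j ≈ ε) → sumᴹ t ≈ t a
  sum-supported-at {m = suc m} a t vanish =
    ≈-trans (sumᴹ-remove {i = a} t)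
    (≈-trans (∙-congˡ (≈-trans (sum-cong-≋ (λ j → vanish (punchIn a j) (punchInᵢ≢i a j)))
                               (sumᴹ-replicate-zero m)))
             (identityʳ (t a)))

∑ℤ≡sum : ∀ n (f : Fin n → ℤ) → ∑ℤ n f ≡ sum f
∑ℤ≡sum zero f = ≡.refl
∑ℤ≡sum (suc n) f = ≡.cong (_+_ (f zero)) (∑ℤ≡sum n (f ∘ suc))

sum-zero : (f : Fin m → ℤ) → (∀ i → f i ≡ 0ℤ) → sum f ≡ 0ℤ
sum-zero {m} f f≡0 = ≡.trans (sum-cong-≗ f≡0) (sum-replicate-zero m)

dot : (Fin m → ℤ) → (Fin m → ℤ) → ℤ
dot x y = sum (λ j → x j * y j)

dot-comm : (x y : Fin m → ℤ) → dot x y ≡ dot y x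
dot-comm x y = sum-cong-≗ (λ j → ℤ.*-comm (x j) (y j))

dot-linear : ∀ α β (x y w : Fin m → ℤ) →
  dot (λ j → α * x j + β * y j) w ≡ α * dot x w + β * dot y w
dot-linear α β x y w = begin
  dot (λ j → α * x j + β * y j) w
    ≡⟨ sum-cong-≗ (λ j → regroup α β (x j) (y j) (w j)) ⟩
  sum (λ j → α * (x j * w j) + β * (y j * w j))
    ≡⟨ ∑-distrib-+ (λ j → α * (x j * w j)) (λ j → β * (y j * w j)) ⟩
  sum (λ j → α * (x j * w j)) + sum (λ j → β * (y j * w j))
    ≡⟨ ≡.cong₂ _+_ (*-distribˡ-sum α (λ j → x j * w j)) (*-distribˡ-sum β (λ j → y j * w j)) ⟨
  α * dot x w + β * dot y w ∎
  where
  open ≡.≡-Reasoning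
  regroup : ∀ α β x y w → (α * x + β * y) * w ≡ α * (x * w) + β * (y * w)
  regroup = solve-∀

dot-scaleʳ : ∀ α (x w : Fin m → ℤ) → dot x (λ j → α * w j) ≡ α * dot x w
dot-scaleʳ α x w = begin
  dot x (λ j → α * w j)      ≡⟨ sum-cong-≗ (λ j → swap α (x j) (w j)) ⟩
  sum (λ j → α * (x j * w j)) ≡⟨ *-distribˡ-sum α (λ j → x j * w j) ⟨
  α * dot x w                ∎
  where
  open ≡.≡-Reasoning
  swap : ∀ α x w → x * (α * w) ≡ α * (x * w)
  swap = solve-∀

dot-combination : (a : Fin k → ℤ) (v : Fin k → Fin m → ℤ) (w : Fin m → ℤ) →
  dot (λ j → sum (λ i → a i * v i j)) w ≡ sum (λ i → a i * dot (v i) w)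
dot-combination {k} {m} a v w = begin
  sum (λ j → sum (λ i → a i * v i j) * w j)
    ≡⟨ sum-cong-≗ (λ j → *-distribʳ-sum (w j) (λ i → a i * v i j)) ⟩
  sum (λ j → sum (λ i → a i * v i j * w j))
    ≡⟨ ∑-comm (λ j i → a i * v i j * w j) ⟩
  sum (λ i → sum (λ j → a i * v i j * w j))
    ≡⟨ sum-cong-≗ (λ i → ≡.trans (sum-cong-≗ (λ j → ℤ.*-assoc (a i) (v i j) (w j)))
                               (≡.sym (*-distribˡ-sum (a i) (λ j → v i j * w j)))) ⟩
  sum (λ i → a i * dot (v i) w) ∎
  where open ≡.≡-Reasoning

δ : Fin m → Fin m → ℤ
δ a j with a ≟ j
... | yes _ = 1ℤ
... | no  _ = 0ℤ

δ-refl : (a : Fin m) → δ a a ≡ 1ℤ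
δ-refl a with a ≟ a
... | yes _ = ≡.refl
... | no a≢a = contradiction ≡.refl a≢a

δ-≢ : {a j : Fin m} → a ≢ j → δ a j ≡ 0ℤ
δ-≢ {a = a} {j} a≢j with a ≟ j
... | yes a≡j = contradiction a≡j a≢j
... | no _ = ≡.refl

dot-δ : (x : Fin m → ℤ) (a : Fin m) → dot x (δ a) ≡ x a
dot-δ x a = begin
  dot x (δ a)  ≡⟨ sum-supported-at ℤ.+-0-commutativeMonoid a _
                    (λ j j≢a → ≡.trans (≡.cong (x j *_) (δ-≢ (j≢a ∘ ≡.sym))) (ℤ.*-zeroʳ (x j))) ⟩
  x a * δ a a  ≡⟨ ≡.cong (x a *_) (δ-refl a) ⟩
  x a * 1ℤ     ≡⟨ ℤ.*-identityʳ (x a) ⟩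
  x a          ∎
  where open ≡.≡-Reasoning

-- Elimination on the first unknown: a row p with nonzero leading entry α clears the leading
-- entries of the other rows, and back substitution scales the remaining unknowns by α.
underdetermined-system-solvable : k ℕ.< m → (A : Fin k → Fin m → ℤ) →
  ∃ λ w → NonZeroVec m w × (∀ i → dot (A i) w ≡ 0ℤ)
underdetermined-system-solvable {zero} {suc m} _ A =
  (λ _ → 1ℤ) , (λ w≡0 → contradiction (w≡0 zero) λ ()) , λ ()
underdetermined-system-solvable {suc k} {suc m} k<m A with any? (λ i → ¬? (A i zero ℤ.≟ 0ℤ))
... | no noPivot =
  δ zero , (λ w≡0 → contradiction (≡.trans (≡.sym (δ-refl {suc m} zero)) (w≡0 zero)) λ ()) ,
  λ i → ≡.trans (dot-δ (A i) zero)
              (decidable-stable (A i zero ℤ.≟ 0ℤ) (λ Ai0≢0 → noPivot (i , Ai0≢0)))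
... | yes (p , α≢0) = w , w≢0 , w-solves
  where
  open ≡.≡-Reasoning
  α : ℤ
  α = A p zero
  tail : Fin (suc k) → Fin m → ℤ
  tail i j = A i (suc j)
  B : Fin k → Fin m → ℤ
  B i j = α * tail (punchIn p i) j + (- A (punchIn p i) zero) * tail p j
  solution = underdetermined-system-solvable (s<s⁻¹ k<m) B
  w′ : Fin m → ℤ
  w′ = proj₁ solution
  w : Fin (suc m) → ℤ
  w zero = - dot (tail p) w′
  w (suc j) = α * w′ j
  w≢0 : NonZeroVec (suc m) w
  w≢0 w≡0 = proj₁ (proj₂ solution) λ j →
    [ (λ α≡0 → contradiction α≡0 α≢0) , (λ w′j≡0 → w′j≡0) ]′
      (ℤ.i*j≡0⇒i≡0∨j≡0 α (w≡0 (suc j)))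
  dot-w : ∀ i → dot (A i) w ≡ A i zero * - dot (tail p) w′ + α * dot (tail i) w′
  dot-w i = ≡.cong (_+_ (A i zero * - dot (tail p) w′)) (dot-scaleʳ α (tail i) w′)
  w-solves : ∀ i → dot (A i) w ≡ 0ℤ
  w-solves i with p ≟ i
  ... | yes ≡.refl = ≡.trans (dot-w p) (cancel α (dot (tail p) w′))
    where
    cancel : ∀ α s → α * - s + α * s ≡ 0ℤ
    cancel = solve-∀
  ... | no p≢i = ≡.subst (λ i → dot (A i) w ≡ 0ℤ) (punchIn-punchOut p≢i) (begin
    dot (A i′) w                                            ≡⟨ dot-w i′ ⟩
    A i′ zero * - dot (tail p) w′ + α * dot (tail i′) w′    ≡⟨ rearrange (A i′ zero) _ α (dot (tail i′) w′) ⟩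
    α * dot (tail i′) w′ + (- A i′ zero) * dot (tail p) w′  ≡⟨ dot-linear α (- A i′ zero) (tail i′) (tail p) w′ ⟨
    dot (B (punchOut p≢i)) w′                               ≡⟨ proj₂ (proj₂ solution) (punchOut p≢i) ⟩
    0ℤ                                                      ∎)
    where
    i′ = punchIn p (punchOut p≢i)
    rearrange : ∀ a s α t → a * - s + α * t ≡ α * t + (- a) * s
    rearrange = solve-∀

-- Independent families of integer vectors.

Independent : (Fin k → Fin m → ℤ) → Set
Independent {k} {m} v = ∀ (a : Fin k → ℤ) → (∀ j → sum (λ i → a i * v i j) ≡ 0ℤ) → ∀ i → a i ≡ 0ℤ

-- Pairing a relation with `w` kills every term except that of `u`, so the coefficient of `u` is 0
-- and what remains is a relation among the `v i`.
independent-cons : {v : Fin k → Fin m → ℤ} {u w : Fin m → ℤ} → Independent v →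
  (∀ i → dot (v i) w ≡ 0ℤ) → dot u w ≢ 0ℤ → Independent (u Vector.∷ v)
independent-cons {v = v} {u} {w} indep v⊥w u⊥̸w a relation = λ where
    zero → a₀≡0
    (suc i) → indep (a ∘ suc) tail-relation i
  where
  open ≡.≡-Reasoning
  a₀*dot≡0 : a zero * dot u w ≡ 0ℤ
  a₀*dot≡0 = begin
    a zero * dot u w
      ≡⟨ ℤ.+-identityʳ _ ⟨
    a zero * dot u w + 0ℤ
      ≡⟨ ≡.cong (_+_ (a zero * dot u w))
           (sum-zero _ λ i → ≡.trans (≡.cong (a (suc i) *_) (v⊥w i)) (ℤ.*-zeroʳ (a (suc i)))) ⟨
    sum (λ i → a i * dot ((u Vector.∷ v) i) w)
      ≡⟨ dot-combination a (u Vector.∷ v) w ⟨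
    dot (λ j → sum (λ i → a i * (u Vector.∷ v) i j)) w
      ≡⟨ sum-zero _ (λ j → ≡.cong (_* w j) (relation j)) ⟩
    0ℤ ∎
  a₀≡0 : a zero ≡ 0ℤ
  a₀≡0 = [ (λ a₀≡0 → a₀≡0) , (λ dot≡0 → contradiction dot≡0 u⊥̸w) ]′
           (ℤ.i*j≡0⇒i≡0∨j≡0 (a zero) a₀*dot≡0)
  tail-relation : ∀ j → sum (λ i → a (suc i) * v i j) ≡ 0ℤ
  tail-relation j = begin
    sum (λ i → a (suc i) * v i j)                  ≡⟨ ℤ.+-identityˡ _ ⟨
    0ℤ * u j + sum (λ i → a (suc i) * v i j)       ≡⟨ ≡.cong (λ z → z * u j + sum (λ i → a (suc i) * v i j)) a₀≡0 ⟨
    a zero * u j + sum (λ i → a (suc i) * v i j)   ≡⟨ relation j ⟩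
    0ℤ ∎

-- The vectors found so far together with the all-ones vector are fewer than `m` linear forms, so
-- they have a common nonzero solution `w`. The all-ones row makes the sum of `w` vanish, as
-- `separate` demands, and a vector not orthogonal to `w` extends the family.
independent-family : (P : (Fin m → ℤ) → Set p) →
  (∀ w → NonZeroVec m w → sum w ≡ 0ℤ → ∃ λ u → P u × dot u w ≢ 0ℤ) →
  ∀ k → k ℕ.< m → ∃ λ (v : Fin k → Fin m → ℤ) → (∀ i → P (v i)) × Independent v
independent-family P separate zero k<m = (λ ()) , (λ ()) , λ a relation ()
independent-family {m} P separate (suc k) k<m =
  let v , Pv , indep = independent-family P separate k (ℕ.<-trans (ℕ.n<1+n k) k<m)
      w , w≢0 , w-solves = underdetermined-system-solvable k<m ((λ _ → 1ℤ) Vector.∷ v)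
      sum-w≡0 = ≡.trans (sum-cong-≗ (λ j → ≡.sym (ℤ.*-identityˡ (w j)))) (w-solves zero)
      u , Pu , u⊥̸w = separate w w≢0 sum-w≡0
  in (u Vector.∷ v) , (λ { zero → Pu ; (suc i) → Pv i }) , independent-cons {v = v} {u} {w} indep (w-solves ∘ suc) u⊥̸w

-- Short vectors of coordinate sum 0.

sum-nonneg : (f : Fin m → ℤ) → (∀ i → 0ℤ ≤ f i) → 0ℤ ≤ sum f
sum-nonneg {zero} f 0≤f = ℤ.≤-refl
sum-nonneg {suc m} f 0≤f = ℤ.+-mono-≤ (0≤f zero) (sum-nonneg (f ∘ suc) (0≤f ∘ suc))

term≤sum : (f : Fin m → ℤ) → (∀ i → 0ℤ ≤ f i) → ∀ i → f i ≤ sum f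
term≤sum {suc m} f 0≤f zero =
  ≡.subst (_≤ sum f) (ℤ.+-identityʳ (f zero)) (ℤ.+-monoʳ-≤ (f zero) (sum-nonneg (f ∘ suc) (0≤f ∘ suc)))
term≤sum {suc m} f 0≤f (suc i) =
  ≡.subst (_≤ sum f) (ℤ.+-identityˡ (f (suc i))) (ℤ.+-mono-≤ (0≤f zero) (term≤sum (f ∘ suc) (0≤f ∘ suc) i))

sum-neg : (f : Fin m → ℤ) → sum (λ i → - f i) ≡ - sum f
sum-neg f = begin
  sum (λ i → - f i)        ≡⟨ sum-cong-≗ (λ i → ≡.sym (ℤ.-1*i≡-i (f i))) ⟩
  sum (λ i → ℤ.-1ℤ * f i)  ≡⟨ *-distribˡ-sum ℤ.-1ℤ f ⟨
  ℤ.-1ℤ * sum f            ≡⟨ ℤ.-1*i≡-i (sum f) ⟩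
  - sum f                  ∎
  where open ≡.≡-Reasoning

sum-difference : (f g : Fin m → ℤ) → sum (λ i → f i - g i) ≡ sum f - sum g
sum-difference f g = ≡.trans (∑-distrib-+ f (λ i → - g i)) (≡.cong (_+_ (sum f)) (sum-neg g))

-- Otherwise the negated entries are nonnegative with sum 0, and each of them is bounded by that
-- sum.
∃-positive : (f : Fin m → ℤ) → NonZeroVec m f → sum f ≡ 0ℤ → ∃ λ i → 0ℤ < f i
∃-positive f f≢0 sum≡0 with any? (λ i → 0ℤ ℤ.<? f i)
... | yes positive = positive
... | no none = contradiction f≡0 f≢0
  where
  0≤-f : ∀ i → 0ℤ ≤ - f i
  0≤-f i = ℤ.neg-mono-≤ (ℤ.≮⇒≥ (λ 0<fi → none (i , 0<fi)))
  sum-neg≡0 : sum (λ i → - f i) ≡ 0ℤ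
  sum-neg≡0 = ≡.trans (sum-neg f) (≡.cong -_ sum≡0)
  f≡0 : ∀ i → f i ≡ 0ℤ
  f≡0 i = ℤ.neg-injective
    (ℤ.≤-antisym (≡.subst (- f i ≤_) sum-neg≡0 (term≤sum (λ i → - f i) 0≤-f i)) (0≤-f i))

∃-negative : (f : Fin m → ℤ) → NonZeroVec m f → sum f ≡ 0ℤ → ∃ λ i → f i < 0ℤ
∃-negative f f≢0 sum≡0 =
  let i , 0<-fi = ∃-positive (λ i → - f i) (λ -f≡0 → f≢0 (ℤ.neg-injective ∘ -f≡0))
                             (≡.trans (sum-neg f) (≡.cong -_ sum≡0))
  in i , ℤ.neg-cancel-< 0<-fi

square-nonneg : ∀ x → 0ℤ ≤ x * x
square-nonneg (+ zero) = ℤ.≤-refl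
square-nonneg (+ suc n) = ℤ.+≤+ z≤n
square-nonneg -[1+ n ] = ℤ.+≤+ z≤n

dot-nonneg : (x : Fin m → ℤ) → 0ℤ ≤ dot x x
dot-nonneg x = sum-nonneg _ (λ i → square-nonneg (x i))

square-of-sum : (x d : Fin m → ℤ) →
  dot (λ k → x k + d k) (λ k → x k + d k) ≡ dot x x + (+ 2 * dot x d + dot d d)
square-of-sum x d = begin
  dot (λ k → x k + d k) (λ k → x k + d k)
    ≡⟨ sum-cong-≗ (λ k → expand (x k) (d k)) ⟩
  sum (λ k → x k * x k + (+ 2 * (x k * d k) + d k * d k))
    ≡⟨ ∑-distrib-+ (λ k → x k * x k) _ ⟩
  dot x x + sum (λ k → + 2 * (x k * d k) + d k * d k)
    ≡⟨ ≡.cong (_+_ (dot x x)) (∑-distrib-+ (λ k → + 2 * (x k * d k)) (λ k → d k * d k)) ⟩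
  dot x x + (sum (λ k → + 2 * (x k * d k)) + dot d d)
    ≡⟨ ≡.cong (λ s → dot x x + (s + dot d d)) (*-distribˡ-sum (+ 2) (λ k → x k * d k)) ⟨
  dot x x + (+ 2 * dot x d + dot d d) ∎
  where
  open ≡.≡-Reasoning
  expand : ∀ x d → (x + d) * (x + d) ≡ x * x + (+ 2 * (x * d) + d * d)
  expand = solve-∀

sum-δ : (a : Fin m) → sum (δ a) ≡ 1ℤ
sum-δ a = ≡.trans (sum-cong-≗ (λ k → ≡.sym (ℤ.*-identityˡ (δ a k)))) (dot-δ (λ _ → 1ℤ) a)

-- The root `e_i - e_j`.
edge : Fin m → Fin m → Fin m → ℤ
edge i j k = δ i k - δ j k

dot-edge : (x : Fin m → ℤ) (i j : Fin m) → dot x (edge i j) ≡ x i - x j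
dot-edge x i j = begin
  dot x (edge i j)                            ≡⟨ sum-cong-≗ (λ k → distrib (x k) (δ i k) (δ j k)) ⟩
  sum (λ k → x k * δ i k - x k * δ j k)       ≡⟨ sum-difference (λ k → x k * δ i k) (λ k → x k * δ j k) ⟩
  dot x (δ i) - dot x (δ j)                   ≡⟨ ≡.cong₂ _-_ (dot-δ x i) (dot-δ x j) ⟩
  x i - x j                                   ∎
  where
  open ≡.≡-Reasoning
  distrib : ∀ x a b → x * (a - b) ≡ x * a - x * b
  distrib = solve-∀

sum-edge : (i j : Fin m) → sum (edge i j) ≡ 0ℤ
sum-edge i j = ≡.trans (sum-difference (δ i) (δ j)) (≡.cong₂ _-_ (sum-δ i) (sum-δ j))

edge-norm : {i j : Fin m} → i ≢ j → dot (edge i j) (edge i j) ≡ + 2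
edge-norm {i = i} {j} i≢j = ≡.trans (dot-edge (edge i j) i j)
  (≡.cong₂ _-_ (≡.cong₂ _-_ (δ-refl i) (δ-≢ (i≢j ∘ ≡.sym))) (≡.cong₂ _-_ (δ-≢ i≢j) (δ-refl j)))

-- Moves one unit from coordinate `i` to coordinate `j`.
shift : Fin m → Fin m → (Fin m → ℤ) → Fin m → ℤ
shift i j x k = x k + edge j i k

-- Take `x i` positive and `x j` negative. Moving one unit from `i` to `j` changes the squared norm
-- by `2 (x j - x i) + 2`, and `x j - x i` is at most -2.
edge-descent : (x : Fin m → ℤ) → NonZeroVec m x → sum x ≡ 0ℤ → ∃₂ λ i j →
  i ≢ j × sum (shift i j x) ≡ 0ℤ × dot (shift i j x) (shift i j x) + + 2 ≤ dot x x
edge-descent x x≢0 sum≡0 with ∃-positive x x≢0 sum≡0 | ∃-negative x x≢0 sum≡0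
... | i , 0<xi | j , xj<0 = i , j , i≢j , sum-shift , norm-shift
  where
  i≢j : i ≢ j
  i≢j ≡.refl = ℤ.<-asym 0<xi xj<0
  sum-shift : sum (shift i j x) ≡ 0ℤ
  sum-shift = ≡.trans (∑-distrib-+ x (edge j i)) (≡.cong₂ _+_ sum≡0 (sum-edge j i))
  gap : x j - x i ≤ - + 2
  gap = ℤ.+-mono-≤ (ℤ.i<j⇒i≤pred[j] xj<0) (ℤ.neg-mono-≤ (ℤ.i<j⇒suc[i]≤j 0<xi))
  norm-shift : dot (shift i j x) (shift i j x) + + 2 ≤ dot x x
  norm-shift = begin
    dot (shift i j x) (shift i j x) + + 2
      ≡⟨ ≡.cong (_+ + 2) (square-of-sum x (edge j i)) ⟩
    dot x x + (+ 2 * dot x (edge j i) + dot (edge j i) (edge j i)) + + 2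
      ≡⟨ ≡.cong₂ (λ s t → dot x x + (+ 2 * s + t) + + 2) (dot-edge x j i) (edge-norm (i≢j ∘ ≡.sym)) ⟩
    dot x x + (+ 2 * (x j - x i) + + 2) + + 2
      ≤⟨ ℤ.+-monoˡ-≤ (+ 2) (ℤ.+-monoʳ-≤ (dot x x) (ℤ.+-monoˡ-≤ (+ 2) (ℤ.*-monoˡ-≤-nonNeg (+ 2) gap))) ⟩
    dot x x + (+ 2 * - + 2 + + 2) + + 2
      ≡⟨ cancel (dot x x) ⟩
    dot x x ∎
    where
    open ℤ.≤-Reasoning
    cancel : ∀ s → s + (+ 2 * - + 2 + + 2) + + 2 ≡ s
    cancel = solve-∀

-- Two descent steps would make the norm negative, so the first one already reaches 0.
short⇒edge : (x : Fin m → ℤ) → NonZeroVec m x → sum x ≡ 0ℤ → dot x x < + 4 →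
  ∃₂ λ i j → i ≢ j × (∀ k → x k ≡ edge i j k)
short⇒edge {m} x x≢0 sum-x short = i , j , i≢j , x≡edge
  where
  open ℤ.≤-Reasoning
  step = edge-descent x x≢0 sum-x
  i j : Fin m
  i = proj₁ step
  j = proj₁ (proj₂ step)
  i≢j = proj₁ (proj₂ (proj₂ step))
  y : Fin m → ℤ
  y = shift i j x
  sum-y : sum y ≡ 0ℤ
  sum-y = proj₁ (proj₂ (proj₂ (proj₂ step)))
  norm-y : dot y y + + 2 ≤ dot x x
  norm-y = proj₂ (proj₂ (proj₂ (proj₂ step)))
  y≢0⇒4≤norm : NonZeroVec m y → + 4 ≤ dot x x
  y≢0⇒4≤norm y≢0 =
    let i′ , j′ , _ , _ , norm-z = edge-descent y y≢0 sum-y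
        z = shift i′ j′ y
    in begin
      + 4                  ≤⟨ ℤ.+-monoˡ-≤ (+ 4) (dot-nonneg z) ⟩
      dot z z + + 4        ≡⟨ ℤ.+-assoc (dot z z) (+ 2) (+ 2) ⟨
      dot z z + + 2 + + 2  ≤⟨ ℤ.+-monoˡ-≤ (+ 2) norm-z ⟩
      dot y y + + 2        ≤⟨ norm-y ⟩
      dot x x              ∎
  y≡0 : ∀ k → y k ≡ 0ℤ
  y≡0 = decidable-stable (all? (λ k → y k ℤ.≟ 0ℤ)) (λ y≢0 → ℤ.<⇒≱ short (y≢0⇒4≤norm y≢0))
  split : ∀ x a b → x ≡ (x + (b - a)) + (a - b)
  split = solve-∀
  x≡edge : ∀ k → x k ≡ edge i j k
  x≡edge k = ≡.trans (split (x k) (δ i k) (δ j k))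
                   (≡.trans (≡.cong (_+ edge i j k) (y≡0 k)) (ℤ.+-identityˡ (edge i j k)))

-- The vector `e_p + e_q - e_r - e_s`. Indices may coincide, so that the minimal vectors for the
-- groups of order 2 and 3 have this form too.
quad : Fin m → Fin m → Fin m → Fin m → Fin m → ℤ
quad p q r s k = edge p r k + edge q s k

dot-quad : (x : Fin m → ℤ) (p q r s : Fin m) → dot x (quad p q r s) ≡ (x p - x r) + (x q - x s)
dot-quad x p q r s = begin
  dot x (quad p q r s)
    ≡⟨ sum-cong-≗ (λ k → ℤ.*-distribˡ-+ (x k) (edge p r k) (edge q s k)) ⟩
  sum (λ k → x k * edge p r k + x k * edge q s k)
    ≡⟨ ∑-distrib-+ (λ k → x k * edge p r k) (λ k → x k * edge q s k) ⟩
  dot x (edge p r) + dot x (edge q s)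
    ≡⟨ ≡.cong₂ _+_ (dot-edge x p r) (dot-edge x q s) ⟩
  (x p - x r) + (x q - x s) ∎
  where open ≡.≡-Reasoning

sum-quad : (p q r s : Fin m) → sum (quad p q r s) ≡ 0ℤ
sum-quad p q r s = ≡.trans (∑-distrib-+ (edge p r) (edge q s)) (≡.cong₂ _+_ (sum-edge p r) (sum-edge q s))

module _ {p q r s : Fin m} (p≢q : p ≢ q) (p≢r : p ≢ r) (p≢s : p ≢ s)
  (q≢r : q ≢ r) (q≢s : q ≢ s) (r≢s : r ≢ s) where

  private
    at : ∀ k {a b c d} → δ p k ≡ a → δ r k ≡ b → δ q k ≡ c → δ s k ≡ d →
      quad p q r s k ≡ (a - b) + (c - d)
    at k ≡.refl ≡.refl ≡.refl ≡.refl = ≡.refl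

  quad-first : quad p q r s p ≡ 1ℤ
  quad-first = at p (δ-refl p) (δ-≢ (p≢r ∘ ≡.sym)) (δ-≢ (p≢q ∘ ≡.sym)) (δ-≢ (p≢s ∘ ≡.sym))

  quad-norm : dot (quad p q r s) (quad p q r s) ≡ + 4
  quad-norm = ≡.trans (dot-quad (quad p q r s) p q r s)
    (≡.cong₂ _+_
      (≡.cong₂ _-_ quad-first
                 (at r (δ-≢ p≢r) (δ-refl r) (δ-≢ q≢r) (δ-≢ (r≢s ∘ ≡.sym))))
      (≡.cong₂ _-_ (at q (δ-≢ p≢q) (δ-≢ (q≢r ∘ ≡.sym)) (δ-refl q) (δ-≢ (q≢s ∘ ≡.sym)))
                 (at s (δ-≢ p≢s) (δ-≢ r≢s) (δ-≢ q≢s) (δ-refl s))))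

  quad-nonzero : NonZeroVec m (quad p q r s)
  quad-nonzero quad≡0 = contradiction (≡.trans (≡.sym quad-first) (quad≡0 p)) λ ()

-- Integer facts and exhaustive checks in two to four coordinates.

∃-maximum : (f : Fin m → ℤ) → Fin m → ∃ λ i → ∀ j → f j ≤ f i
∃-maximum {suc zero} f _ = zero , λ { zero → ℤ.≤-refl }
∃-maximum {suc (suc m)} f _ with ∃-maximum (f ∘ suc) zero
... | i , max with ℤ.≤-total (f zero) (f (suc i))
... | inj₁ f0≤fi = suc i , λ { zero → f0≤fi ; (suc j) → max j }
... | inj₂ fi≤f0 = zero , λ { zero → ℤ.≤-refl ; (suc j) → ℤ.≤-trans (max j) fi≤f0 }

t+t≡0⇒t≡0 : ∀ t → t + t ≡ 0ℤ → t ≡ 0ℤ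
t+t≡0⇒t≡0 t t+t≡0 = [ (λ ()) , (λ t≡0 → t≡0) ]′
  (ℤ.i*j≡0⇒i≡0∨j≡0 (+ 2) (≡.trans (double t) t+t≡0))
  where
  double : ∀ t → + 2 * t ≡ t + t
  double = solve-∀

-- The integers from -2 to 2, indexed by a finite type so that claims about vectors with such
-- entries are decided by exhaustive search.
small : Fin 5 → ℤ
small k = + toℕ k - + 2

Small : ℤ → Set
Small x = ∃ λ k → x ≡ small k

square<9⇒small : ∀ x → x * x < + 9 → Small x
square<9⇒small (+ 0) _ = 2F , ≡.refl
square<9⇒small (+ 1) _ = 3F , ≡.refl
square<9⇒small (+ 2) _ = 4F , ≡.refl
square<9⇒small -[1+ 0 ] _ = 1F , ≡.refl
square<9⇒small -[1+ 1 ] _ = 0F , ≡.refl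
square<9⇒small (+ suc (suc (suc n))) x²<9 =
  contradiction x²<9 (ℤ.≤⇒≯ (ℤ.+≤+ (ℕ.*-mono-≤ (ℕ.m≤m+n 3 n) (ℕ.m≤m+n 3 n))))
square<9⇒small -[1+ suc (suc n) ] x²<9 =
  contradiction x²<9 (ℤ.≤⇒≯ (ℤ.+≤+ (ℕ.*-mono-≤ (ℕ.m≤m+n 3 n) (ℕ.m≤m+n 3 n))))

norm<9⇒small-entries : (x : Fin m → ℤ) → dot x x < + 9 → ∀ i → Small (x i)
norm<9⇒small-entries x norm<9 i = square<9⇒small (x i)
  (ℤ.≤-<-trans (term≤sum (λ j → x j * x j) (λ j → square-nonneg (x j)) i) norm<9)

-- The bound 4 excludes the roots e_i - e_j, of norm 2; here and below norms are squared.
norm≥8 : (x : Fin 2 → ℤ) → sum x ≡ 0ℤ → + 4 ≤ dot x x → + 8 ≤ dot x x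
norm≥8 x sum-x 4≤norm = ℤ.≮⇒≥ λ norm<8 →
  let entries = norm<9⇒small-entries x (ℤ.<-trans norm<8 (toWitness {a? = + 8 ℤ.<? + 9} tt))
  in ℤ.<⇒≱ (gap (entries 0F) (entries 1F) sum-x norm<8) 4≤norm
  where
  Gap : ℤ → ℤ → Set
  Gap a b = a + (b + 0ℤ) ≡ 0ℤ → a * a + (b * b + 0ℤ) < + 8 → a * a + (b * b + 0ℤ) < + 4
  gap? : Dec (∀ i j → Gap (small i) (small j))
  gap? = all? λ i → all? λ j → (_ ℤ.≟ _) →-dec ((_ ℤ.<? _) →-dec (_ ℤ.<? _))
  gap : ∀ {a b} → Small a → Small b → Gap a b
  gap (i , ≡.refl) (j , ≡.refl) = toWitness {a? = gap?} tt i j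

norm≥6 : (x : Fin 3 → ℤ) → sum x ≡ 0ℤ → + 4 ≤ dot x x → + 6 ≤ dot x x
norm≥6 x sum-x 4≤norm = ℤ.≮⇒≥ λ norm<6 →
  let entries = norm<9⇒small-entries x (ℤ.<-trans norm<6 (toWitness {a? = + 6 ℤ.<? + 9} tt))
  in ℤ.<⇒≱ (gap (entries 0F) (entries 1F) (entries 2F) sum-x norm<6) 4≤norm
  where
  Gap : ℤ → ℤ → ℤ → Set
  Gap a b c = a + (b + (c + 0ℤ)) ≡ 0ℤ →
    a * a + (b * b + (c * c + 0ℤ)) < + 6 → a * a + (b * b + (c * c + 0ℤ)) < + 4
  gap? : Dec (∀ i j k → Gap (small i) (small j) (small k))
  gap? = all? λ i → all? λ j → all? λ k → (_ ℤ.≟ _) →-dec ((_ ℤ.<? _) →-dec (_ ℤ.<? _))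
  gap : ∀ {a b c} → Small a → Small b → Small c → Gap a b c
  gap (i , ≡.refl) (j , ≡.refl) (k , ≡.refl) = toWitness {a? = gap?} tt i j k

-- All entries lie between -2 and 2, which leaves finitely many tuples to check. The two exceptions
-- are the alternating vectors `(1, -1, 1, -1)` and its negative.
norm≡4-classification : (x : Fin 4 → ℤ) → sum x ≡ 0ℤ → dot x x ≡ + 4 →
  (x 0F + x 2F ≡ 0ℤ × x 1F + x 3F ≡ 0ℤ) ⊎ x ≗ quad 0F 2F 1F 3F ⊎ x ≗ quad 1F 3F 0F 2F
norm≡4-classification x sum-x norm≡4 =
  let entries = norm<9⇒small-entries x (≡.subst (_< + 9) (≡.sym norm≡4) (toWitness {a? = + 4 ℤ.<? + 9} tt))
  in Sum.map₂ (Sum.map pointwise pointwise) (classify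
       (entries 0F) (entries 1F) (entries 2F) (entries 3F) sum-x norm≡4)
  where
  Entries : (Fin 4 → ℤ) → ℤ → ℤ → ℤ → ℤ → Set
  Entries y a b c d = a ≡ y 0F × b ≡ y 1F × c ≡ y 2F × d ≡ y 3F
  Classified : ℤ → ℤ → ℤ → ℤ → Set
  Classified a b c d = a + (b + (c + (d + 0ℤ))) ≡ 0ℤ →
    a * a + (b * b + (c * c + (d * d + 0ℤ))) ≡ + 4 →
    (a + c ≡ 0ℤ × b + d ≡ 0ℤ) ⊎ Entries (quad 0F 2F 1F 3F) a b c d ⊎ Entries (quad 1F 3F 0F 2F) a b c d
  entries? : ∀ y a b c d → Dec (Entries y a b c d)
  entries? y a b c d = (a ℤ.≟ y 0F) ×-dec (b ℤ.≟ y 1F) ×-dec (c ℤ.≟ y 2F) ×-dec (d ℤ.≟ y 3F)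
  classified? : Dec (∀ i j k l → Classified (small i) (small j) (small k) (small l))
  classified? = all? λ i → all? λ j → all? λ k → all? λ l →
    (_ ℤ.≟ _) →-dec ((_ ℤ.≟ _) →-dec
    (((_ ℤ.≟ _) ×-dec (_ ℤ.≟ _)) ⊎-dec
     (entries? (quad 0F 2F 1F 3F) _ _ _ _ ⊎-dec entries? (quad 1F 3F 0F 2F) _ _ _ _)))
  classify : ∀ {a b c d} → Small a → Small b → Small c → Small d → Classified a b c d
  classify (i , ≡.refl) (j , ≡.refl) (k , ≡.refl) (l , ≡.refl) = toWitness {a? = classified?} tt i j k l
  pointwise : {y : Fin 4 → ℤ} → Entries y (x 0F) (x 1F) (x 2F) (x 3F) → x ≗ y
  pointwise (x₀ , x₁ , x₂ , x₃) = λ { 0F → x₀ ; 1F → x₁ ; 2F → x₂ ; 3F → x₃ }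

-- Integer multiples in an abelian group and weights of integer vectors.

module Weights (G : AbelianGroup c ℓ) where
  open AbelianGroup G hiding (_-_)
  open import Algebra.Properties.AbelianGroup G public
  open import Algebra.Properties.CommutativeSemigroup commutativeSemigroup using (interchange)
  open import Algebra.Properties.CommutativeMonoid.Sum commutativeMonoid using ()
    renaming (sum to sumᴳ; sum-cong-≋ to sumᴳ-cong; ∑-distrib-+ to sumᴳ-distrib-∙)
  open import Relation.Binary.Reasoning.Setoid setoid

  ∑G≡sum : ∀ n (f : Fin n → Carrier) → ∑G G n f ≡ sumᴳ f
  ∑G≡sum zero f = ≡.refl
  ∑G≡sum (suc n) f = ≡.cong (f zero ∙_) (∑G≡sum n (f ∘ suc))

  natMul-+ : ∀ m n g → natMul G (m ℕ.+ n) g ≈ natMul G m g ∙ natMul G n g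
  natMul-+ zero n g = sym (identityˡ _)
  natMul-+ (suc m) n g = trans (∙-congˡ (natMul-+ m n g)) (sym (assoc _ _ _))

  -- Integers of opposite signs are added through `⊖`, so this is the mixed case of `intMul-+`.
  intMul-⊖ : ∀ m n g → intMul G (m ⊖ n) g ≈ natMul G m g ∙ natMul G n g ⁻¹
  intMul-⊖ zero zero g = sym (inverseʳ ε)
  intMul-⊖ zero (suc n) g = sym (identityˡ _)
  intMul-⊖ (suc m) zero g = sym (trans (∙-congˡ ε⁻¹≈ε) (identityʳ _))
  intMul-⊖ (suc m) (suc n) g = begin
    intMul G (suc m ⊖ suc n) g          ≡⟨ ≡.cong (λ z → intMul G z g) (ℤ.[1+m]⊖[1+n]≡m⊖n m n) ⟩
    intMul G (m ⊖ n) g                  ≈⟨ intMul-⊖ m n g ⟩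
    x ∙ y ⁻¹                            ≈⟨ identityˡ _ ⟨
    ε ∙ (x ∙ y ⁻¹)                      ≈⟨ ∙-congʳ (inverseʳ g) ⟨
    (g ∙ g ⁻¹) ∙ (x ∙ y ⁻¹)             ≈⟨ interchange g (g ⁻¹) x (y ⁻¹) ⟩
    (g ∙ x) ∙ (g ⁻¹ ∙ y ⁻¹)             ≈⟨ ∙-congˡ (⁻¹-∙-comm g y) ⟩
    (g ∙ x) ∙ (g ∙ y) ⁻¹                ∎
    where
    x y : Carrier
    x = natMul G m g
    y = natMul G n g

  intMul-+ : ∀ x y g → intMul G (x + y) g ≈ intMul G x g ∙ intMul G y g
  intMul-+ (+ m) (+ n) g = natMul-+ m n g
  intMul-+ (+ m) -[1+ n ] g = intMul-⊖ m (suc n) g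
  intMul-+ -[1+ m ] (+ n) g = trans (intMul-⊖ n (suc m) g) (comm _ _)
  intMul-+ -[1+ m ] -[1+ n ] g = begin
    natMul G (suc (suc (m ℕ.+ n))) g ⁻¹         ≡⟨ ≡.cong (λ k → natMul G (suc k) g ⁻¹) (ℕ.+-suc m n) ⟨
    natMul G (suc m ℕ.+ suc n) g ⁻¹             ≈⟨ ⁻¹-cong (natMul-+ (suc m) (suc n) g) ⟩
    (natMul G (suc m) g ∙ natMul G (suc n) g) ⁻¹ ≈⟨ ⁻¹-∙-comm _ _ ⟨
    natMul G (suc m) g ⁻¹ ∙ natMul G (suc n) g ⁻¹ ∎

  natMul-cong : ∀ n {g h} → g ≈ h → natMul G n g ≈ natMul G n h
  natMul-cong zero g≈h = refl
  natMul-cong (suc n) g≈h = ∙-cong g≈h (natMul-cong n g≈h)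

  intMul-cong : ∀ x {g h} → g ≈ h → intMul G x g ≈ intMul G x h
  intMul-cong (+ n) g≈h = natMul-cong n g≈h
  intMul-cong -[1+ n ] g≈h = ⁻¹-cong (natMul-cong (suc n) g≈h)

  natMul-ε : ∀ n → natMul G n ε ≈ ε
  natMul-ε zero = refl
  natMul-ε (suc n) = trans (identityˡ _) (natMul-ε n)

  intMul-ε : ∀ x → intMul G x ε ≈ ε
  intMul-ε (+ n) = natMul-ε n
  intMul-ε -[1+ n ] = trans (⁻¹-cong (natMul-ε (suc n))) ε⁻¹≈ε

  weight : (Fin m → Carrier) → (Fin m → ℤ) → Carrier
  weight h x = sumᴳ (λ j → intMul G (x j) (h j))

  module _ (h : Fin m → Carrier) where

    weight-cong : {x y : Fin m → ℤ} → x ≗ y → weight h x ≈ weight h y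
    weight-cong x≗y = sumᴳ-cong (λ j → reflexive (≡.cong (λ z → intMul G z (h j)) (x≗y j)))

    weight-+ : (x y : Fin m → ℤ) → weight h (λ k → x k + y k) ≈ weight h x ∙ weight h y
    weight-+ x y = trans (sumᴳ-cong (λ j → intMul-+ (x j) (y j) (h j)))
                         (sumᴳ-distrib-∙ (λ j → intMul G (x j) (h j)) (λ j → intMul G (y j) (h j)))

    weight-δ : (a : Fin m) → weight h (δ a) ≈ h a
    weight-δ a = begin
      weight h (δ a)           ≈⟨ sum-supported-at commutativeMonoid a _ (λ j j≢a →
                                    reflexive (≡.cong (λ z → intMul G z (h j)) (δ-≢ (j≢a ∘ ≡.sym)))) ⟩
      intMul G (δ a a) (h a)   ≡⟨ ≡.cong (λ z → intMul G z (h a)) (δ-refl a) ⟩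
      h a ∙ ε                  ≈⟨ identityʳ (h a) ⟩
      h a                      ∎

    -- Adding `δ j` back gives `δ i`, so additivity of the weight suffices and no rule for negated
    -- vectors is called for.
    weight-edge : (i j : Fin m) → weight h (edge i j) ≈ h i ∙ h j ⁻¹
    weight-edge i j = x≈z//y _ _ _ (begin
      weight h (edge i j) ∙ h j             ≈⟨ ∙-congˡ (weight-δ j) ⟨
      weight h (edge i j) ∙ weight h (δ j)  ≈⟨ weight-+ (edge i j) (δ j) ⟨
      weight h (λ k → edge i j k + δ j k)   ≈⟨ weight-cong (λ k → a-b+b≡a (δ i k) (δ j k)) ⟩
      weight h (δ i)                        ≈⟨ weight-δ i ⟩
      h i                                   ∎)
      where
      a-b+b≡a : ∀ a b → (a - b) + b ≡ a
      a-b+b≡a = solve-∀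

    weight-quad : (p q r s : Fin m) → weight h (quad p q r s) ≈ (h p ∙ h q) ∙ (h r ∙ h s) ⁻¹
    weight-quad p q r s = begin
      weight h (quad p q r s)                        ≈⟨ weight-+ (edge p r) (edge q s) ⟩
      weight h (edge p r) ∙ weight h (edge q s)      ≈⟨ ∙-cong (weight-edge p r) (weight-edge q s) ⟩
      (h p ∙ h r ⁻¹) ∙ (h q ∙ h s ⁻¹)                ≈⟨ interchange (h p) (h r ⁻¹) (h q) (h s ⁻¹) ⟩
      (h p ∙ h q) ∙ (h r ⁻¹ ∙ h s ⁻¹)                ≈⟨ ∙-congˡ (⁻¹-∙-comm (h r) (h s)) ⟩
      (h p ∙ h q) ∙ (h r ∙ h s) ⁻¹                   ∎

    -- A symmetric form of `InL` that singles out no coordinate. For the labelling built from a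
    -- listing the two are shown equivalent by `InL⇒InLattice` and `InLattice⇒InL`.
    InLattice : (Fin m → ℤ) → Set ℓ
    InLattice x = sum x ≡ 0ℤ × weight h x ≈ ε

    quad-inLattice : ∀ p q r s → h p ∙ h q ≈ h r ∙ h s → InLattice (quad p q r s)
    quad-inLattice p q r s eq =
      sum-quad p q r s , trans (weight-quad p q r s) (x≈y⇒x∙y⁻¹≈ε eq)

-- The lattice with coordinates indexed by the elements of a finite group.

module FiniteGroup (G : AbelianGroup c ℓ) {N : ℕ} (h : Fin N → AbelianGroup.Carrier G)
  (h-injective : ∀ i j → AbelianGroup._≈_ G (h i) (h j) → i ≡ j)
  (h-surjective : ∀ x → ∃ λ i → AbelianGroup._≈_ G (h i) x) where

  open AbelianGroup G hiding (_-_)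
  open Weights G
  open import Algebra.Properties.CommutativeMonoid.Sum commutativeMonoid using ()
    renaming (sum-permute to sumᴳ-permute)

  idx : Carrier → Fin N
  idx x = proj₁ (h-surjective x)

  h-idx : ∀ x → h (idx x) ≈ x
  h-idx x = proj₂ (h-surjective x)

  idx-cong : ∀ {x y} → x ≈ y → idx x ≡ idx y
  idx-cong {x} {y} x≈y = h-injective _ _ (trans (h-idx x) (trans x≈y (sym (h-idx y))))

  idx-injective : ∀ {x y} → idx x ≡ idx y → x ≈ y
  idx-injective {x} {y} eq = trans (sym (h-idx x)) (trans (reflexive (≡.cong h eq)) (h-idx y))

  idx-h : ∀ i → idx (h i) ≡ i
  idx-h i = h-injective _ _ (h-idx (h i))

  infix 4 _≈?_
  _≈?_ : Decidable _≈_
  x ≈? y = map′ idx-injective idx-cong (idx x ≟ idx y)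

  -- Pigeonhole: if `xs` met every element, sending an element to its position in `xs` would inject
  -- `N` indices into fewer positions.
  fresh : (xs : List Carrier) → length xs ℕ.< N → ∃ λ c → All (λ x → ¬ c ≈ x) xs
  fresh xs |xs|<N with any? (λ i → ¬? (Any.any? (h i ≈?_) xs))
  ... | yes (i , hi∉xs) = h i , ¬Any⇒All¬ xs hi∉xs
  ... | no covered = contradiction (λ {i} {j} → position-injective {i} {j}) (<⇒notInjective |xs|<N)
    where
    found : ∀ i → Any (h i ≈_) xs
    found i = decidable-stable (Any.any? (h i ≈?_) xs) (λ hi∉xs → covered (i , hi∉xs))
    position-injective : ∀ {i j} → index (found i) ≡ index (found j) → i ≡ j
    position-injective {i} {j} eq = h-injective i j (trans (lookup-index (found i))
      (trans (reflexive (≡.cong (lookup xs) eq)) (sym (lookup-index (found j)))))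

  lattice-norm≥4 : (x : Fin N → ℤ) → InLattice h x → NonZeroVec N x → + 4 ≤ dot x x
  lattice-norm≥4 x (sum-x , weight-x) x≢0 = ℤ.≮⇒≥ λ short →
    let i , j , i≢j , x≗edge = short⇒edge x x≢0 sum-x short
    in i≢j (h-injective i j (x∙y⁻¹≈ε⇒x≈y _ _ (trans (sym (weight-edge h i j))
         (trans (weight-cong h (≡.sym ∘ x≗edge)) weight-x))))

  -- Exactly the condition for `0`, `a + b`, `a`, `b` to be pairwise distinct: `a + b` differs from
  -- `a` and from `b` because `a` and `b` are nonzero.
  Generic : Carrier → Carrier → Set ℓ
  Generic a b = ¬ a ≈ ε × ¬ b ≈ ε × ¬ a ≈ b × ¬ a ∙ b ≈ ε

  generic? : Decidable Generic
  generic? a b = ¬? (a ≈? ε) ×-dec ¬? (b ≈? ε) ×-dec ¬? (a ≈? b) ×-dec ¬? (a ∙ b ≈? ε)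

  ∃-generic : 4 ℕ.≤ N → ∃₂ Generic
  ∃-generic 4≤N with fresh (ε ∷ []) (ℕ.≤-trans (ℕ.m≤m+n 2 2) 4≤N)
  -- Avoiding the inverse of `a` keeps `a + b` nonzero; these three forbidden values are why four
  -- elements are required.
  ... | a , a≉ε ∷ [] with fresh (ε ∷ a ∷ a ⁻¹ ∷ []) 4≤N
  ... | b , b≉ε ∷ b≉a ∷ b≉a⁻¹ ∷ [] = a , b , a≉ε , b≉ε , b≉a ∘ sym , b≉a⁻¹ ∘ inverseʳ-unique a b

  parallelogram : Carrier → Carrier → Fin N → ℤ
  parallelogram a b = quad (idx ε) (idx (a ∙ b)) (idx a) (idx b)

  parallelogram-inLattice : ∀ a b → InLattice h (parallelogram a b)
  parallelogram-inLattice a b = quad-inLattice h _ _ _ _ (trans (∙-cong (h-idx ε) (h-idx (a ∙ b)))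
    (trans (identityˡ (a ∙ b)) (sym (∙-cong (h-idx a) (h-idx b)))))

  module _ {a b : Carrier} (generic : Generic a b) where

    private
      a≉ε = proj₁ generic
      b≉ε = proj₁ (proj₂ generic)
      a≉b = proj₁ (proj₂ (proj₂ generic))
      ab≉ε = proj₂ (proj₂ (proj₂ generic))

      distinct : ∀ {x y} → ¬ x ≈ y → idx x ≢ idx y
      distinct x≉y = x≉y ∘ idx-injective

      ab≉a : ¬ a ∙ b ≈ a
      ab≉a = b≉ε ∘ identityʳ-unique a b

      ab≉b : ¬ a ∙ b ≈ b
      ab≉b = a≉ε ∘ identityˡ-unique a b

    parallelogram-norm : dot (parallelogram a b) (parallelogram a b) ≡ + 4
    parallelogram-norm = quad-norm (distinct (ab≉ε ∘ sym)) (distinct (a≉ε ∘ sym))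
      (distinct (b≉ε ∘ sym)) (distinct ab≉a) (distinct ab≉b) (distinct a≉b)

    parallelogram-nonzero : NonZeroVec N (parallelogram a b)
    parallelogram-nonzero = quad-nonzero (distinct (ab≉ε ∘ sym)) (distinct (a≉ε ∘ sym))
      (distinct (b≉ε ∘ sym)) (distinct ab≉a) (distinct ab≉b) (distinct a≉b)

  -- Integer-valued functions that are additive on generic pairs.

  module GenericallyAdditive (ψ : Carrier → ℤ) (ψ-cong : ∀ {x y} → x ≈ y → ψ x ≡ ψ y) (ψ-ε : ψ ε ≡ 0ℤ)
    (ψ-generic : ∀ a b → Generic a b → ψ (a ∙ b) ≡ ψ a + ψ b) where

    open ≡.≡-Reasoning

    -- A pair containing `0` is covered by `ψ-ε`; every other pair allowed here is generic.
    additive-off-diagonal : ∀ a b → ¬ a ≈ b → ¬ a ∙ b ≈ ε → ψ (a ∙ b) ≡ ψ a + ψ b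
    additive-off-diagonal a b a≉b ab≉ε with a ≈? ε | b ≈? ε
    ... | yes a≈ε | _ = begin
      ψ (a ∙ b)  ≡⟨ ψ-cong (trans (∙-congʳ a≈ε) (identityˡ b)) ⟩
      ψ b        ≡⟨ ℤ.+-identityˡ (ψ b) ⟨
      0ℤ + ψ b   ≡⟨ ≡.cong (_+ ψ b) (≡.trans (ψ-cong a≈ε) ψ-ε) ⟨
      ψ a + ψ b  ∎
    ... | no _ | yes b≈ε = begin
      ψ (a ∙ b)  ≡⟨ ψ-cong (trans (∙-congˡ b≈ε) (identityʳ a)) ⟩
      ψ a        ≡⟨ ℤ.+-identityʳ (ψ a) ⟨
      ψ a + 0ℤ   ≡⟨ ≡.cong (_+_ (ψ a)) (≡.trans (ψ-cong b≈ε) ψ-ε) ⟨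
      ψ a + ψ b  ∎
    ... | no a≉ε | no b≉ε = ψ-generic a b (a≉ε , b≉ε , a≉b , ab≉ε)

    -- Expand ψ (a + (a + c)) = ψ c for some c outside {0, a}.
    vanishes-on-involution : 3 ℕ.≤ N → ∀ a → a ∙ a ≈ ε → ψ a ≡ 0ℤ
    vanishes-on-involution 3≤N a aa≈ε with fresh (ε ∷ a ∷ []) 3≤N
    ... | c , c≉ε ∷ c≉a ∷ [] = t+t≡0⇒t≡0 (ψ a) (begin
      ψ a + ψ a                  ≡⟨ regroup (ψ a) (ψ c) ⟩
      ψ a + (ψ a + ψ c) - ψ c    ≡⟨ ≡.cong (_- ψ c) expansion ⟨
      ψ c - ψ c                  ≡⟨ ℤ.+-inverseʳ (ψ c) ⟩
      0ℤ                         ∎)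
      where
      regroup : ∀ t s → t + t ≡ t + (t + s) - s
      regroup = solve-∀
      aac≈c : a ∙ (a ∙ c) ≈ c
      aac≈c = trans (sym (assoc a a c)) (trans (∙-congʳ aa≈ε) (identityˡ c))
      expansion : ψ c ≡ ψ a + (ψ a + ψ c)
      expansion = begin
        ψ c                  ≡⟨ ψ-cong aac≈c ⟨
        ψ (a ∙ (a ∙ c))      ≡⟨ additive-off-diagonal a (a ∙ c)
                                  (c≉ε ∘ identityʳ-unique a c ∘ sym) (c≉ε ∘ trans (sym aac≈c)) ⟩
        ψ a + ψ (a ∙ c)      ≡⟨ ≡.cong (_+_ (ψ a)) (additive-off-diagonal a c (c≉a ∘ sym)
                                  (λ ac≈ε → c≉a (∙-cancelˡ a c a (trans ac≈ε (sym aa≈ε))))) ⟩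
        ψ a + (ψ a + ψ c)    ∎

    module _ (5≤N : 5 ℕ.≤ N) where

      -- Expand ψ (- a + (a + c)) = ψ c for some c outside {0, a, - a, - 2 a}.
      odd : ∀ a → ψ (a ⁻¹) ≡ - ψ a
      odd a with fresh (ε ∷ a ∷ a ⁻¹ ∷ a ⁻¹ ∙ a ⁻¹ ∷ []) 5≤N
      ... | c , c≉ε ∷ c≉a ∷ c≉a⁻¹ ∷ c≉a⁻² ∷ [] = begin
        ψ (a ⁻¹)                             ≡⟨ regroup (ψ (a ⁻¹)) (ψ a) (ψ c) ⟩
        ψ (a ⁻¹) + (ψ a + ψ c) - ψ c - ψ a   ≡⟨ ≡.cong (λ s → s - ψ c - ψ a) expansion ⟨
        ψ c - ψ c - ψ a                      ≡⟨ cancel (ψ c) (ψ a) ⟩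
        - ψ a                                ∎
        where
        regroup : ∀ t s r → t ≡ t + (s + r) - r - s
        regroup = solve-∀
        cancel : ∀ r s → r - r - s ≡ - s
        cancel = solve-∀
        expansion : ψ c ≡ ψ (a ⁻¹) + (ψ a + ψ c)
        expansion = begin
          ψ c                     ≡⟨ ψ-cong (\\-leftDividesʳ a c) ⟨
          ψ (a ⁻¹ ∙ (a ∙ c))      ≡⟨ additive-off-diagonal (a ⁻¹) (a ∙ c)
                                       (λ a⁻¹≈ac → c≉a⁻² (trans (sym (\\-leftDividesʳ a c)) (∙-congˡ (sym a⁻¹≈ac))))
                                       (c≉ε ∘ trans (sym (\\-leftDividesʳ a c))) ⟩
          ψ (a ⁻¹) + ψ (a ∙ c)    ≡⟨ ≡.cong (_+_ (ψ (a ⁻¹))) (additive-off-diagonal a c (c≉a ∘ sym)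
                                       (c≉a⁻¹ ∘ inverseʳ-unique a c)) ⟩
          ψ (a ⁻¹) + (ψ a + ψ c)  ∎

      -- The pairs still missing consist of an element and its inverse, where oddness gives the
      -- claim.
      additive-on-distinct : ∀ a b → ¬ a ≈ b → ψ (a ∙ b) ≡ ψ a + ψ b
      additive-on-distinct a b a≉b with a ∙ b ≈? ε
      ... | no ab≉ε = additive-off-diagonal a b a≉b ab≉ε
      ... | yes ab≈ε = begin
        ψ (a ∙ b)       ≡⟨ ≡.trans (ψ-cong ab≈ε) ψ-ε ⟩
        0ℤ              ≡⟨ ℤ.+-inverseʳ (ψ a) ⟨
        ψ a - ψ a       ≡⟨ ≡.cong (_+_ (ψ a)) (≡.trans (ψ-cong (inverseʳ-unique a b ab≈ε)) (odd a)) ⟨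
        ψ a + ψ b       ∎

      -- Compare a + (a + c) with (a + a) + c for some c outside {0, a, 2 a}.
      doubling : ∀ a → ψ (a ∙ a) ≡ ψ a + ψ a
      doubling a with fresh (ε ∷ a ∷ a ∙ a ∷ []) (ℕ.≤-trans (ℕ.n≤1+n 4) 5≤N)
      ... | c , c≉ε ∷ c≉a ∷ c≉aa ∷ [] = +-cancelʳ (ψ c) _ _ (begin
        ψ (a ∙ a) + ψ c      ≡⟨ additive-on-distinct (a ∙ a) c (c≉aa ∘ sym) ⟨
        ψ ((a ∙ a) ∙ c)      ≡⟨ ψ-cong (assoc a a c) ⟩
        ψ (a ∙ (a ∙ c))      ≡⟨ additive-on-distinct a (a ∙ c) (c≉ε ∘ identityʳ-unique a c ∘ sym) ⟩
        ψ a + ψ (a ∙ c)      ≡⟨ ≡.cong (_+_ (ψ a)) (additive-on-distinct a c (c≉a ∘ sym)) ⟩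
        ψ a + (ψ a + ψ c)    ≡⟨ ℤ.+-assoc (ψ a) (ψ a) (ψ c) ⟨
        ψ a + ψ a + ψ c      ∎)

      -- If `ψ` is maximal at `a`, then `2 ψ a = ψ (2 a)` is at most `ψ a`, so the maximum is at
      -- most 0.
      nonpositive : ∀ x → ψ x ≤ 0ℤ
      nonpositive x with ∃-maximum (ψ ∘ h) (idx ε)
      ... | i , max = ℤ.≤-trans (≡.subst (_≤ ψ a) (ψ-cong (h-idx x)) (max (idx x))) ψa≤0
        where
        a : Carrier
        a = h i
        ψaa≤ψa : ψ a + ψ a ≤ ψ a
        ψaa≤ψa = ≡.subst (_≤ ψ a) (≡.trans (ψ-cong (h-idx (a ∙ a))) (doubling a)) (max (idx (a ∙ a)))
        ψa≤0 : ψ a ≤ 0ℤ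
        ψa≤0 = ℤ.≮⇒≥ λ 0<ψa →
          ℤ.<⇒≱ (≡.subst (_< ψ a + ψ a) (ℤ.+-identityʳ (ψ a)) (ℤ.+-monoʳ-< (ψ a) 0<ψa)) ψaa≤ψa

      -- By oddness, the upper bound at the inverse of `x` is a lower bound at `x`.
      vanishes : ∀ x → ψ x ≡ 0ℤ
      vanishes x = ℤ.≤-antisym (nonpositive x)
        (ℤ.neg-cancel-≤ (≡.subst (_≤ 0ℤ) (odd x) (nonpositive (x ⁻¹))))

  -- By duality, this says that the parallelogram vectors span the root space.
  parallelogram-separates : 5 ℕ.≤ N ⊎ (3 ℕ.≤ N × (∀ a → a ∙ a ≈ ε)) →
    ∀ w → NonZeroVec N w → sum w ≡ 0ℤ →
    ∃₂ λ a b → Generic a b × dot (parallelogram a b) w ≢ 0ℤ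
  parallelogram-separates large w w≢0 sum-w
    with any? (λ i → any? (λ j → generic? (h i) (h j) ×-dec ¬? (dot (parallelogram (h i) (h j)) w ℤ.≟ 0ℤ)))
  ... | yes (i , j , generic , dot≢0) = h i , h j , generic , dot≢0
  ... | no none = contradiction w-constant (ℤ.<⇒≢ (ℤ.<-trans (proj₂ negative) (proj₂ positive)))
    where
    open ≡.≡-Reasoning
    φ ψ : Carrier → ℤ
    φ x = w (idx x)
    ψ x = φ x - φ ε
    φ-cong : ∀ {x y} → x ≈ y → φ x ≡ φ y
    φ-cong x≈y = ≡.cong w (idx-cong x≈y)
    ψ-cong : ∀ {x y} → x ≈ y → ψ x ≡ ψ y
    ψ-cong x≈y = ≡.cong (_- φ ε) (φ-cong x≈y)
    -- The search ran over the listed elements `h i` only, so `a` and `b` are first replaced by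
    -- their listed representatives.
    orthogonal : ∀ a b → Generic a b → (φ ε - φ a) + (φ (a ∙ b) - φ b) ≡ 0ℤ
    orthogonal a b (a≉ε , b≉ε , a≉b , ab≉ε) = begin
      (φ ε - φ a) + (φ (a ∙ b) - φ b)
        ≡⟨ ≡.cong₂ _+_ (≡.cong (λ z → φ ε - z) (φ-cong (sym a′≈a)))
                       (≡.cong₂ _-_ (φ-cong (∙-cong (sym a′≈a) (sym b′≈b))) (φ-cong (sym b′≈b))) ⟩
      (φ ε - φ a′) + (φ (a′ ∙ b′) - φ b′)
        ≡⟨ dot-quad w (idx ε) (idx (a′ ∙ b′)) (idx a′) (idx b′) ⟨
      dot w (parallelogram a′ b′)
        ≡⟨ dot-comm w (parallelogram a′ b′) ⟩
      dot (parallelogram a′ b′) w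
        ≡⟨ decidable-stable (dot (parallelogram a′ b′) w ℤ.≟ 0ℤ)
             (λ dot≢0 → none (idx a , idx b , generic , dot≢0)) ⟩
      0ℤ ∎
      where
      a′ b′ : Carrier
      a′ = h (idx a)
      b′ = h (idx b)
      a′≈a = h-idx a
      b′≈b = h-idx b
      generic : Generic a′ b′
      generic = a≉ε ∘ trans (sym a′≈a) , b≉ε ∘ trans (sym b′≈b)
              , (λ a′≈b′ → a≉b (trans (sym a′≈a) (trans a′≈b′ b′≈b)))
              , ab≉ε ∘ trans (∙-cong (sym a′≈a) (sym b′≈b))
    ψ-generic : ∀ a b → Generic a b → ψ (a ∙ b) ≡ ψ a + ψ b
    ψ-generic a b generic = begin
      φ (a ∙ b) - φ ε       ≡⟨ regroup (φ (a ∙ b)) (φ ε) (φ a) (φ b) ⟩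
      (φ ε - φ a) + (φ (a ∙ b) - φ b) + (ψ a + ψ b)
                            ≡⟨ ≡.cong (_+ (ψ a + ψ b)) (orthogonal a b generic) ⟩
      0ℤ + (ψ a + ψ b)      ≡⟨ ℤ.+-identityˡ _ ⟩
      ψ a + ψ b             ∎
      where
      regroup : ∀ s e a b → s - e ≡ (e - a) + (s - b) + ((a - e) + (b - e))
      regroup = solve-∀
    open GenericallyAdditive ψ ψ-cong (ℤ.+-inverseʳ (φ ε)) ψ-generic
    ψ-vanishes : ∀ x → ψ x ≡ 0ℤ
    ψ-vanishes x = [ (λ 5≤N → vanishes 5≤N x)
                   , (λ (3≤N , involutive) → vanishes-on-involution 3≤N x (involutive x)) ]′ large
    w≡φε : ∀ j → w j ≡ φ ε
    w≡φε j = ≡.trans (≡.cong w (≡.sym (idx-h j))) (ℤ.i-j≡0⇒i≡j _ _ (ψ-vanishes (h j)))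
    -- A nonzero vector of sum 0 has entries of both signs, which rules out the constancy just
    -- found.
    positive = ∃-positive w w≢0 sum-w
    negative = ∃-negative w w≢0 sum-w
    w-constant : w (proj₁ negative) ≡ w (proj₁ positive)
    w-constant = ≡.trans (w≡φε _) (≡.sym (w≡φε _))

  -- Counting distinct elements and recognising small cyclic groups.

  Distinct : List Carrier → Set _
  Distinct = AllPairs (λ x y → ¬ x ≈ y)

  distinct-lookup-injective : ∀ {xs} → Distinct xs → ∀ i j → lookup xs i ≈ lookup xs j → i ≡ j
  distinct-lookup-injective (_ ∷ _) zero zero _ = ≡.refl
  distinct-lookup-injective {_ ∷ xs} (x≉xs ∷ _) zero (suc j) eq =
    contradiction eq (All.lookup x≉xs (∈-lookup {xs = xs} j))
  distinct-lookup-injective {_ ∷ xs} (x≉xs ∷ _) (suc i) zero eq =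
    contradiction (sym eq) (All.lookup x≉xs (∈-lookup {xs = xs} i))
  distinct-lookup-injective (_ ∷ distinct) (suc i) (suc j) eq =
    ≡.cong suc (distinct-lookup-injective distinct i j eq)

  length-distinct≤ : ∀ {xs} → Distinct xs → length xs ℕ.≤ N
  length-distinct≤ {xs} distinct = injective⇒≤ {f = idx ∘ lookup xs}
    (λ {i} {j} eq → distinct-lookup-injective distinct i j (idx-injective eq))

  private
    quotient-≉ : ∀ {x y z u} → ¬ u ∙ z ≈ x ∙ y → ¬ u ≈ (x ∙ y) ∙ z ⁻¹
    quotient-≉ {x} {y} {z} uz≉xy u≈ = uz≉xy (trans (∙-congʳ u≈) (//-rightDividesˡ z (x ∙ y)))

  -- (x + x) - y is neither x nor, unless x + x = y + y, the element y.
  doubles-agree : N ℕ.< 3 → ∀ {x y} → ¬ x ≈ y → x ∙ x ≈ y ∙ y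
  doubles-agree N<3 {x} {y} x≉y = decidable-stable (x ∙ x ≈? y ∙ y) λ xx≉yy →
    ℕ.<⇒≱ N<3 (length-distinct≤ {x ∷ y ∷ (x ∙ x) ∙ y ⁻¹ ∷ []}
      ( (x≉y ∷ quotient-≉ (λ xy≈xx → x≉y (sym (∙-cancelˡ x y x xy≈xx))) ∷ [])
      ∷ (quotient-≉ (xx≉yy ∘ sym) ∷ [])
      ∷ [] ∷ []))

  -- (x + y) - z is neither x nor y, so it is z.
  three-sum : N ℕ.< 4 → ∀ {x y z} → ¬ x ≈ y → ¬ x ≈ z → ¬ y ≈ z → x ∙ y ≈ z ∙ z
  three-sum N<4 {x} {y} {z} x≉y x≉z y≉z = decidable-stable (x ∙ y ≈? z ∙ z) λ xy≉zz →
    ℕ.<⇒≱ N<4 (length-distinct≤ {x ∷ y ∷ z ∷ (x ∙ y) ∙ z ⁻¹ ∷ []}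
      ( (x≉y ∷ x≉z ∷ quotient-≉ (λ xz≈xy → y≉z (sym (∙-cancelˡ x z y xz≈xy))) ∷ [])
      ∷ (y≉z ∷ quotient-≉ (λ yz≈xy → x≉z (sym (∙-cancelˡ y z x (trans yz≈xy (comm x y))))) ∷ [])
      ∷ (quotient-≉ (xy≉zz ∘ sym) ∷ [])
      ∷ [] ∷ []))

  natMul-∸ : ∀ {i j} a → i ℕ.≤ j → natMul G i a ≈ natMul G j a → natMul G (j ℕ.∸ i) a ≈ ε
  natMul-∸ {i} {j} a i≤j eq = identityʳ-unique (natMul G i a) _ (trans
    (sym (natMul-+ i (j ℕ.∸ i) a))
    (trans (reflexive (≡.cong (λ k → natMul G k a) (ℕ.m+[n∸m]≡n i≤j))) (sym eq)))

  -- Prepending a missed element to `f` would give `suc N` distinct elements of a group of order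
  -- `N`.
  injective⇒surjective : (f : Fin N → Carrier) → (∀ i j → f i ≈ f j → i ≡ j) → ∀ x → ∃ λ i → f i ≈ x
  injective⇒surjective f f-injective x = decidable-stable (any? (λ i → f i ≈? x)) λ x∉f →
    ℕ.<-irrefl ≡.refl (injective⇒≤ {f = idx ∘ (x Vector.∷ f)} (extended-injective x∉f _ _ ∘ idx-injective))
    where
    extended-injective : ¬ (∃ λ i → f i ≈ x) → ∀ i j → (x Vector.∷ f) i ≈ (x Vector.∷ f) j → i ≡ j
    extended-injective x∉f zero zero _ = ≡.refl
    extended-injective x∉f zero (suc j) eq = contradiction (j , sym eq) x∉f
    extended-injective x∉f (suc i) zero eq = contradiction (i , eq) x∉f
    extended-injective x∉f (suc i) (suc j) eq = ≡.cong suc (f-injective i j eq)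

  module _ .{{_ : NonZero N}} (a : Carrier) (order : ∀ k → 0 ℕ.< k → k ℕ.< N → ¬ natMul G k a ≈ ε) where

    private
      multiple : Fin N → Carrier
      multiple i = natMul G (toℕ i) a

      multiple-injective-≤ : ∀ {i j} → i ℕ.≤ j → j ℕ.< N → natMul G i a ≈ natMul G j a → i ≡ j
      multiple-injective-≤ {i} {j} i≤j j<N eq = ℕ.≤-antisym i≤j (ℕ.m∸n≡0⇒m≤n
        (ℕ.n≤0⇒n≡0 (ℕ.≮⇒≥ λ 0<j∸i →
          order (j ℕ.∸ i) 0<j∸i (ℕ.≤-<-trans (ℕ.m∸n≤m j i) j<N) (natMul-∸ a i≤j eq))))

      multiple-injective : ∀ i j → multiple i ≈ multiple j → i ≡ j
      multiple-injective i j eq with ℕ.≤-total (toℕ i) (toℕ j)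
      ... | inj₁ i≤j = toℕ-injective (multiple-injective-≤ i≤j (toℕ<n j) eq)
      ... | inj₂ j≤i = toℕ-injective (≡.sym (multiple-injective-≤ j≤i (toℕ<n i) (sym eq)))

      -- The multiple `N a` equals some `k a` with `k < N`, so `(N - k) a` vanishes; by `order` this
      -- is possible only if `N - k = N`.
      natMul-N≈ε : natMul G N a ≈ ε
      natMul-N≈ε with injective⇒surjective multiple multiple-injective (natMul G N a)
      ... | k , ka≈Na with natMul-∸ a (ℕ.<⇒≤ (toℕ<n k)) ka≈Na | N ℕ.∸ toℕ k ℕ.<? N
      ... | [N-k]a≈ε | yes N-k<N = contradiction [N-k]a≈ε (order _ (ℕ.m<n⇒0<n∸m (toℕ<n k)) N-k<N)
      ... | [N-k]a≈ε | no N-k≮N = trans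
        (reflexive (≡.cong (λ d → natMul G d a) (ℕ.≤-antisym (ℕ.≮⇒≥ N-k≮N) (ℕ.m∸n≤m N (toℕ k))))) [N-k]a≈ε

      natMul-[q*N]≈ε : ∀ q → natMul G (q ℕ.* N) a ≈ ε
      natMul-[q*N]≈ε zero = refl
      natMul-[q*N]≈ε (suc q) = trans (natMul-+ N (q ℕ.* N) a)
        (trans (∙-cong natMul-N≈ε (natMul-[q*N]≈ε q)) (identityˡ ε))

      natMul-% : ∀ k → natMul G (k % N) a ≈ natMul G k a
      natMul-% k = sym (trans (reflexive (≡.cong (λ k → natMul G k a) (m≡m%n+[m/n]*n k N)))
        (trans (natMul-+ (k % N) (k / N ℕ.* N) a) (trans (∙-congˡ (natMul-[q*N]≈ε (k / N))) (identityʳ _))))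

    -- The multiples `k a` with `k < N` are distinct by `order` and therefore exhaust the group. As
    -- `N a` vanishes, reducing modulo `N` does not change a multiple, which gives compatibility
    -- with `addMod`.
    generator⇒isoCyclic : IsoCyclic G N
    generator⇒isoCyclic = multiple
      , (λ i j → trans (reflexive (≡.cong (λ k → natMul G k a) (toℕ-fromℕ< (m%n<n (toℕ i ℕ.+ toℕ j) N))))
                       (trans (natMul-% (toℕ i ℕ.+ toℕ j)) (natMul-+ (toℕ i) (toℕ j) a)))
      , multiple-injective
      , injective⇒surjective multiple multiple-injective

  order2⇒isoCyclic : .{{_ : NonZero N}} → N ≡ 2 → IsoCyclic G N
  order2⇒isoCyclic N≡2 with fresh (ε ∷ []) (ℕ.≤-reflexive (≡.sym N≡2))
  ... | a , a≉ε ∷ [] = generator⇒isoCyclic a λ where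
    1 _ _ → a≉ε ∘ trans (sym (identityʳ a))
    (suc (suc k)) _ k<N → contradiction (≡.subst (suc (suc k) ℕ.<_) N≡2 k<N) (ℕ.≤⇒≯ (ℕ.m≤m+n 2 k))

  order3⇒isoCyclic : .{{_ : NonZero N}} → N ≡ 3 → IsoCyclic G N
  order3⇒isoCyclic N≡3 with fresh (ε ∷ []) (ℕ.≤-trans (ℕ.n≤1+n 2) (ℕ.≤-reflexive (≡.sym N≡3)))
  ... | a , a≉ε ∷ [] with fresh (ε ∷ a ∷ []) (ℕ.≤-reflexive (≡.sym N≡3))
  ... | b , b≉ε ∷ b≉a ∷ [] = generator⇒isoCyclic a λ where
      1 _ _ → a≉ε ∘ trans (sym (identityʳ a))
      2 _ _ → aa≉ε ∘ trans (sym (∙-congˡ (identityʳ a)))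
      (suc (suc (suc k))) _ k<N → contradiction (≡.subst (suc (suc (suc k)) ℕ.<_) N≡3 k<N) (ℕ.≤⇒≯ (ℕ.m≤m+n 3 k))
    where
    aa≉ε : ¬ a ∙ a ≈ ε
    -- If `2 a` vanished, then `0`, `a`, `b`, `a + b` would be four distinct elements.
    aa≉ε aa≈ε = ℕ.<⇒≱ (ℕ.≤-reflexive (≡.cong suc N≡3)) (length-distinct≤ {ε ∷ a ∷ b ∷ a ∙ b ∷ []}
      ( (a≉ε ∘ sym ∷ b≉ε ∘ sym ∷ (λ ε≈ab → b≉a (∙-cancelˡ a b a (trans (sym ε≈ab) (sym aa≈ε)))) ∷ [])
      ∷ (b≉a ∘ sym ∷ b≉ε ∘ identityʳ-unique a b ∘ sym ∷ [])
      ∷ (a≉ε ∘ identityˡ-unique a b ∘ sym ∷ [])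
      ∷ [] ∷ []))

  -- The element `a` generates: its order exceeds 2, and if `3 a` vanished, then `0`, `a`, `2 a`,
  -- `b`, `a + b` would be five distinct elements for any `b` outside the first three.
  order4⇒isoCyclic : .{{_ : NonZero N}} → N ≡ 4 → ∀ a → ¬ a ∙ a ≈ ε → IsoCyclic G N
  order4⇒isoCyclic N≡4 a aa≉ε with fresh (ε ∷ a ∷ a ∙ a ∷ []) (ℕ.≤-reflexive (≡.sym N≡4))
  ... | b , b≉ε ∷ b≉a ∷ b≉aa ∷ [] = generator⇒isoCyclic a λ where
      1 _ _ → a≉ε ∘ trans (sym (identityʳ a))
      2 _ _ → aa≉ε ∘ trans (sym (∙-congˡ (identityʳ a)))
      3 _ _ → aaa≉ε ∘ trans (sym (∙-congˡ (∙-congˡ (identityʳ a))))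
      (suc (suc (suc (suc k)))) _ k<N →
        contradiction (≡.subst (suc (suc (suc (suc k))) ℕ.<_) N≡4 k<N) (ℕ.≤⇒≯ (ℕ.m≤m+n 4 k))
    where
    a≉ε : ¬ a ≈ ε
    a≉ε a≈ε = aa≉ε (trans (∙-cong a≈ε a≈ε) (identityˡ ε))
    aaa≉ε : ¬ a ∙ (a ∙ a) ≈ ε
    aaa≉ε aaa≈ε = ℕ.<⇒≱ (ℕ.≤-reflexive (≡.cong suc N≡4)) (length-distinct≤ {ε ∷ a ∷ a ∙ a ∷ b ∷ a ∙ b ∷ []}
      ( (a≉ε ∘ sym ∷ aa≉ε ∘ sym ∷ b≉ε ∘ sym
          ∷ (λ ε≈ab → b≉aa (∙-cancelˡ a b (a ∙ a) (trans (sym ε≈ab) (sym aaa≈ε)))) ∷ [])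
      ∷ (a≉ε ∘ identityʳ-unique a a ∘ sym ∷ b≉a ∘ sym ∷ b≉ε ∘ identityʳ-unique a b ∘ sym ∷ [])
      ∷ (b≉aa ∘ sym ∷ (λ aa≈ab → b≉a (sym (∙-cancelˡ a a b aa≈ab))) ∷ [])
      ∷ (a≉ε ∘ identityˡ-unique a b ∘ sym ∷ [])
      ∷ [] ∷ []))

  isoCyclic⇒order : .{{_ : NonZero m}} → IsoCyclic G m → N ≡ m
  isoCyclic⇒order (f , _ , f-injective , f-surjective) = cantor-schröder-bernstein
    {f = λ i → proj₁ (f-surjective (h i))} {g = idx ∘ f}
    (λ {i} {j} eq → h-injective i j (trans (sym (proj₂ (f-surjective (h i))))
                      (trans (reflexive (≡.cong f eq)) (proj₂ (f-surjective (h j))))))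
    (λ {i} {j} eq → f-injective i j (idx-injective eq))

  -- Minimal vectors for the cyclic group of order 4.

  module _ (iso : IsoCyclic G 4) where

    private
      f = proj₁ iso
      f-homo = proj₁ (proj₂ iso)
      f-injective = proj₁ (proj₂ (proj₂ iso))
      f-surjective = proj₂ (proj₂ (proj₂ iso))

      -- Relabels the coordinates by the residues modulo 4.
      π : Permutation 4 N
      π = permutation (idx ∘ f) (λ i → proj₁ (f-surjective (h i)))
        (λ i → ≡.trans (idx-cong (proj₂ (f-surjective (h i)))) (idx-h i))
        (λ a → f-injective _ _ (trans (proj₂ (f-surjective _)) (h-idx (f a))))

      h′ : Fin 4 → Carrier
      h′ a = h (π ⟨$⟩ʳ a)

      h′-sum : ∀ a b → h′ a ∙ h′ b ≈ f (addMod 4 a b)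
      h′-sum a b = trans (∙-cong (h-idx (f a)) (h-idx (f b))) (sym (f-homo a b))

      f0≉f2 : ¬ f 0F ≈ f 2F
      f0≉f2 eq = contradiction (f-injective 0F 2F eq) λ ()

    -- For an alternating vector, zero weight would mean that `0 + 2` and `1 + 3` agree modulo 4,
    -- that is, that 2 equals 0.
    norm4⇒antiperiodic : ∀ x → InLattice h x → dot x x ≡ + 4 →
      x (π ⟨$⟩ʳ 0F) + x (π ⟨$⟩ʳ 2F) ≡ 0ℤ × x (π ⟨$⟩ʳ 1F) + x (π ⟨$⟩ʳ 3F) ≡ 0ℤ
    norm4⇒antiperiodic x (sum-x , weight-x) norm≡4 =
      [ (λ antiperiodic → antiperiodic) , [ (λ x≗ → contradiction x≗ (excluded 0F 2F 1F 3F (f0≉f2 ∘ sym)))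
                                          , (λ x≗ → contradiction x≗ (excluded 1F 3F 0F 2F f0≉f2)) ]′ ]′
      (norm≡4-classification y (≡.trans (≡.sym (sum-permute x π)) sum-x)
                               (≡.trans (≡.sym (sum-permute (λ k → x k * x k) π)) norm≡4))
      where
      y : Fin 4 → ℤ
      y a = x (π ⟨$⟩ʳ a)
      weight-y : weight h′ y ≈ ε
      weight-y = trans (sym (sumᴳ-permute (λ j → intMul G (x j) (h j)) π)) weight-x
      excluded : ∀ p q r s → ¬ f (addMod 4 p q) ≈ f (addMod 4 r s) → ¬ y ≗ quad p q r s
      excluded p q r s pq≉rs y≗ = pq≉rs (trans (sym (h′-sum p q)) (trans
        (x∙y⁻¹≈ε⇒x≈y _ _ (trans (sym (weight-quad h′ p q r s)) (trans (weight-cong h′ (≡.sym ∘ y≗)) weight-y)))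
        (h′-sum r s)))

    -- Antiperiodic vectors form a space of dimension 2.
    norm4-dependent : (v : Fin 3 → Fin N → ℤ) → (∀ k → InLattice h (v k)) → (∀ k → dot (v k) (v k) ≡ + 4) →
      ¬ Independent v
    norm4-dependent v v∈L norm≡4 independent = proj₁ (proj₂ solution) (independent a relation)
      where
      -- Three coefficients and two equations, one for each of the coordinates at residues 0 and 1;
      -- the coordinates at 2 and 3 are their opposites.
      solution = underdetermined-system-solvable {2} {3} (ℕ.n<1+n 2) λ where
        0F k → v k (π ⟨$⟩ʳ 0F)
        1F k → v k (π ⟨$⟩ʳ 1F)
      a : Fin 3 → ℤ
      a = proj₁ solution
      combination : Fin N → ℤ
      combination j = sum (λ k → a k * v k j)
      vanishes-at : ∀ i → dot (λ k → v k (π ⟨$⟩ʳ i)) a ≡ 0ℤ → combination (π ⟨$⟩ʳ i) ≡ 0ℤ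
      vanishes-at i = ≡.trans (dot-comm a (λ k → v k (π ⟨$⟩ʳ i)))
      opposite : ∀ {i j} → (∀ k → v k i + v k j ≡ 0ℤ) → combination i ≡ 0ℤ → combination j ≡ 0ℤ
      opposite {i} {j} opp ci≡0 = ≡.trans (≡.sym (ℤ.+-identityˡ _)) (≡.trans
        (≡.cong (_+ combination j) (≡.sym ci≡0)) (≡.trans
        (≡.sym (∑-distrib-+ (λ k → a k * v k i) (λ k → a k * v k j)))
        (sum-zero _ λ k → ≡.trans (≡.sym (ℤ.*-distribˡ-+ (a k) (v k i) (v k j)))
                                  (≡.trans (≡.cong (_*_ (a k)) (opp k)) (ℤ.*-zeroʳ (a k))))))
      antiperiodic = λ k → norm4⇒antiperiodic (v k) (v∈L k) (norm≡4 k)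
      at : ∀ i → combination (π ⟨$⟩ʳ i) ≡ 0ℤ
      at 0F = vanishes-at 0F (proj₂ (proj₂ solution) 0F)
      at 1F = vanishes-at 1F (proj₂ (proj₂ solution) 1F)
      at 2F = opposite (proj₁ ∘ antiperiodic) (at 0F)
      at 3F = opposite (proj₂ ∘ antiperiodic) (at 1F)
      relation : ∀ j → combination j ≡ 0ℤ
      relation j = ≡.subst (λ j → combination j ≡ 0ℤ) (Perm.inverseʳ π) (at (π ⟨$⟩ˡ j))

-- From the symmetric lattice to the coordinates of a listing.

snoc : ∀ {a} {A : Set a} {n} → (Fin n → A) → A → Fin (suc n) → A
snoc {n = zero} f a _ = a
snoc {n = suc n} f a zero = f zero
snoc {n = suc n} f a (suc i) = snoc (f ∘ suc) a i

snoc-inject₁ : ∀ {a} {A : Set a} {n} (f : Fin n → A) (a : A) i → snoc f a (inject₁ i) ≡ f i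
snoc-inject₁ f a zero = ≡.refl
snoc-inject₁ f a (suc i) = snoc-inject₁ (f ∘ suc) a i

snoc-fromℕ : ∀ {a} {A : Set a} {n} (f : Fin n → A) (a : A) → snoc f a (fromℕ n) ≡ a
snoc-fromℕ {n = zero} f a = ≡.refl
snoc-fromℕ {n = suc n} f a = snoc-fromℕ (f ∘ suc) a

normSq≡dot : ∀ m (x : Fin m → ℤ) → normSq m x ≡ dot x x
normSq≡dot m x = ∑ℤ≡sum m (λ i → x i * x i)

module Listing (G : AbelianGroup c ℓ) (n : ℕ) (e : Fin (suc n) → AbelianGroup.Carrier G)
  (listing : IsListing G n e) where
  open AbelianGroup G hiding (_-_)
  open Weights G
  open import Algebra.Properties.CommutativeMonoid.Sum commutativeMonoid using ()
    renaming (sum to sumᴳ; sum-cong-≋ to sumᴳ-cong; sum-init-last to sumᴳ-init-last)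
  open import Relation.Binary.Reasoning.Setoid setoid

  private
    e-zero = proj₁ listing
    e-injective = proj₁ (proj₂ listing)
    e-surjective = proj₂ (proj₂ listing)

  -- The last coordinate of a vector of the lattice is the one of the zero element.
  h : Fin (suc n) → Carrier
  h = snoc (e ∘ suc) ε

  h-inject₁ : ∀ i → h (inject₁ i) ≡ e (suc i)
  h-inject₁ = snoc-inject₁ (e ∘ suc) ε

  h-fromℕ : h (fromℕ n) ≡ ε
  h-fromℕ = snoc-fromℕ (e ∘ suc) ε

  h-injective : ∀ i j → h i ≈ h j → i ≡ j
  h-injective i j hi≈hj with view i | view j
  ... | ‵fromℕ | ‵fromℕ = ≡.refl
  ... | ‵fromℕ | ‵inject₁ j = contradiction
    (e-injective zero (suc j) (trans e-zero (trans (reflexive (≡.sym h-fromℕ))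
      (trans hi≈hj (reflexive (h-inject₁ j)))))) λ ()
  ... | ‵inject₁ i | ‵fromℕ = contradiction
    (e-injective (suc i) zero (trans (reflexive (≡.sym (h-inject₁ i)))
      (trans hi≈hj (trans (reflexive h-fromℕ) (sym e-zero))))) λ ()
  ... | ‵inject₁ i | ‵inject₁ j = ≡.cong inject₁ (suc-injective (e-injective (suc i) (suc j)
    (trans (reflexive (≡.sym (h-inject₁ i))) (trans hi≈hj (reflexive (h-inject₁ j))))))

  h-surjective : ∀ x → ∃ λ i → h i ≈ x
  h-surjective x with e-surjective x
  ... | zero , e0≈x = fromℕ n , trans (reflexive h-fromℕ) (trans (sym e-zero) e0≈x)
  ... | suc i , ei≈x = inject₁ i , trans (reflexive (h-inject₁ i)) ei≈x

  -- The last coordinate multiplies the zero element and so contributes nothing to the weight.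
  weight≈∑G : ∀ x → weight h x ≈ ∑G G n (λ i → intMul G (x (inject₁ i)) (e (suc i)))
  weight≈∑G x = begin
    weight h x
      ≈⟨ sumᴳ-init-last (λ j → intMul G (x j) (h j)) ⟩
    sumᴳ (λ i → intMul G (x (inject₁ i)) (h (inject₁ i))) ∙ intMul G (x (fromℕ n)) (h (fromℕ n))
      ≈⟨ ∙-cong (sumᴳ-cong (λ i → intMul-cong (x (inject₁ i)) (reflexive (h-inject₁ i))))
                (trans (intMul-cong (x (fromℕ n)) (reflexive h-fromℕ)) (intMul-ε (x (fromℕ n)))) ⟩
    sumᴳ (λ i → intMul G (x (inject₁ i)) (e (suc i))) ∙ ε
      ≈⟨ identityʳ _ ⟩
    sumᴳ (λ i → intMul G (x (inject₁ i)) (e (suc i)))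
      ≡⟨ ∑G≡sum n _ ⟨
    ∑G G n (λ i → intMul G (x (inject₁ i)) (e (suc i))) ∎

  InL⇒InLattice : ∀ x → InL G n e x → InLattice h x
  InL⇒InLattice x (last , ∑≈ε) =
    ≡.trans (sum-init-last x) (≡.trans
      (≡.cong₂ _+_ (≡.sym (∑ℤ≡sum n (x ∘ inject₁))) last) (ℤ.+-inverseʳ (∑ℤ n (x ∘ inject₁)))) ,
    trans (weight≈∑G x) ∑≈ε

  InLattice⇒InL : ∀ x → InLattice h x → InL G n e x
  InLattice⇒InL x (sum≡0 , weight≈ε) = last , trans (sym (weight≈∑G x)) weight≈ε
    where
    last : x (fromℕ n) ≡ - ∑ℤ n (x ∘ inject₁)
    last = +-inverseʳ-unique (∑ℤ n (x ∘ inject₁)) (x (fromℕ n)) (≡.trans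
      (≡.cong (_+ x (fromℕ n)) (∑ℤ≡sum n (x ∘ inject₁)))
      (≡.trans (≡.sym (sum-init-last x)) sum≡0))

  LowerBound : ℤ → Set ℓ
  LowerBound D = ∀ x → InLattice h x → NonZeroVec (suc n) x → D ≤ dot x x

  -- Given `LowerBound D` and some vector that attains `D`, this is equivalent to `Minimal`, with
  -- the minimum named by an explicit number.
  Attains : ℤ → (Fin (suc n) → ℤ) → Set ℓ
  Attains D x = InLattice h x × NonZeroVec (suc n) x × dot x x ≡ D

  module _ {D : ℤ} (bound : LowerBound D) where

    minDistSq : (∃ λ x → Attains D x) → MinDistSq G n e D
    minDistSq (x , x∈L , x≢0 , norm≡D) =
      (x , InLattice⇒InL x x∈L , x≢0 , ≡.trans (normSq≡dot (suc n) x) norm≡D) ,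
      λ y y∈L y≢0 → ≡.subst (D ≤_) (≡.sym (normSq≡dot (suc n) y)) (bound y (InL⇒InLattice y y∈L) y≢0)

    attained⇒minimal : ∀ x → Attains D x → Minimal G n e x
    attained⇒minimal x (x∈L , x≢0 , norm≡D) = InLattice⇒InL x x∈L , x≢0 , λ y y∈L y≢0 →
      ≡.subst (_≤ normSq (suc n) y) (≡.sym (≡.trans (normSq≡dot (suc n) x) norm≡D))
        (proj₂ (minDistSq (x , x∈L , x≢0 , norm≡D)) y y∈L y≢0)

    minimal⇒attained : (∃ λ x → Attains D x) → ∀ x → Minimal G n e x → Attains D x
    minimal⇒attained (y , y∈L , y≢0 , norm-y≡D) x (x∈L , x≢0 , x-min) =
      InL⇒InLattice x x∈L , x≢0 , ℤ.≤-antisym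
        (≡.subst₂ _≤_ (normSq≡dot (suc n) x) (≡.trans (normSq≡dot (suc n) y) norm-y≡D)
          (x-min y (InLattice⇒InL y y∈L) y≢0))
        (bound x (InL⇒InLattice x x∈L) x≢0)

    wellRounded : (∃ λ (v : Fin n → Fin (suc n) → ℤ) → (∀ k → Attains D (v k)) × Independent v) →
      WellRounded G n e
    wellRounded (v , attained , independent) = v , (λ k → attained⇒minimal (v k) (attained k)) ,
      λ a relation → independent a (λ j → ≡.trans (≡.sym (∑ℤ≡sum n (λ k → a k * v k j))) (relation j))

  open FiniteGroup G h h-injective h-surjective

  parallelogram-attains : ∀ {a b} → Generic a b → Attains (+ 4) (parallelogram a b)
  parallelogram-attains {a} {b} generic =
    parallelogram-inLattice a b , parallelogram-nonzero generic , parallelogram-norm generic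

  norm4-attained : 4 ℕ.≤ suc n → ∃ λ x → Attains (+ 4) x
  norm4-attained 4≤N with ∃-generic 4≤N
  ... | a , b , generic = parallelogram a b , parallelogram-attains generic

  minDistSq≡4 : 4 ℕ.≤ suc n → MinDistSq G n e (+ 4)
  minDistSq≡4 4≤N = minDistSq lattice-norm≥4 (norm4-attained 4≤N)

  -- Separation by parallelogram vectors is the hypothesis of `independent-family`, which in `suc n`
  -- coordinates reaches families of `n` vectors.
  parallelograms-wellRounded : 5 ℕ.≤ suc n ⊎ (3 ℕ.≤ suc n × (∀ a → a ∙ a ≈ ε)) → WellRounded G n e
  parallelograms-wellRounded large = wellRounded lattice-norm≥4
    (independent-family (Attains (+ 4)) separate n (ℕ.n<1+n n))
    where
    separate : ∀ w → NonZeroVec (suc n) w → sum w ≡ 0ℤ → ∃ λ u → Attains (+ 4) u × dot u w ≢ 0ℤ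
    separate w w≢0 sum-w with parallelogram-separates large w w≢0 sum-w
    ... | a , b , generic , dot≢0 = parallelogram a b , parallelogram-attains generic , dot≢0

-- The groups of order 2 and 3.

module _ (G : AbelianGroup c ℓ) (e : Fin 2 → AbelianGroup.Carrier G) (listing : IsListing G 1 e) where
  open Listing G 1 e listing
  open Weights G using (quad-inLattice)
  open FiniteGroup G h h-injective h-surjective using (lattice-norm≥4; doubles-agree)

  private
    bound : LowerBound (+ 8)
    bound x x∈L x≢0 = norm≥8 x (proj₁ x∈L) (lattice-norm≥4 x x∈L x≢0)

    -- The vector is `(2, -2)`; it has weight 0 because the two elements of the group have the same
    -- double.
    attained : Attains (+ 8) (quad 0F 0F 1F 1F)
    attained = quad-inLattice h 0F 0F 1F 1F (doubles-agree (ℕ.n<1+n 2)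
                 (λ eq → contradiction (h-injective 0F 1F eq) λ ()))
             , (λ eq → contradiction (eq 0F) λ ()) , ≡.refl

    independent : Independent {1} (λ _ → quad {2} 0F 0F 1F 1F)
    independent a relation 0F = [ (λ a≡0 → a≡0) , (λ ()) ]′
      (ℤ.i*j≡0⇒i≡0∨j≡0 (a 0F) (≡.trans (≡.sym (ℤ.+-identityʳ (a 0F * + 2))) (relation 0F)))

  rank1-minDistSq : MinDistSq G 1 e (+ 8)
  rank1-minDistSq = minDistSq bound (_ , attained)

  rank1-wellRounded : WellRounded G 1 e
  rank1-wellRounded = wellRounded bound (_ , (λ _ → attained) , independent)

module _ (G : AbelianGroup c ℓ) (e : Fin 3 → AbelianGroup.Carrier G) (listing : IsListing G 2 e) where
  open Listing G 2 e listing
  open Weights G using (quad-inLattice)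
  open FiniteGroup G h h-injective h-surjective using (lattice-norm≥4; three-sum)

  private
    bound : LowerBound (+ 6)
    bound x x∈L x≢0 = norm≥6 x (proj₁ x∈L) (lattice-norm≥4 x x∈L x≢0)

    -- The vectors `(1, 1, -2)` and `(1, -2, 1)`.
    v : Fin 2 → Fin 3 → ℤ
    v 0F = quad 0F 1F 2F 2F
    v 1F = quad 0F 2F 1F 1F

    attained : ∀ k → Attains (+ 6) (v k)
    attained 0F = quad-inLattice h 0F 1F 2F 2F (three-sum (ℕ.n<1+n 3)
                    (λ eq → contradiction (h-injective 0F 1F eq) λ ())
                    (λ eq → contradiction (h-injective 0F 2F eq) λ ())
                    (λ eq → contradiction (h-injective 1F 2F eq) λ ()))
                , (λ eq → contradiction (eq 0F) λ ()) , ≡.refl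
    attained 1F = quad-inLattice h 0F 2F 1F 1F (three-sum (ℕ.n<1+n 3)
                    (λ eq → contradiction (h-injective 0F 2F eq) λ ())
                    (λ eq → contradiction (h-injective 0F 1F eq) λ ())
                    (λ eq → contradiction (h-injective 2F 1F eq) λ ()))
                , (λ eq → contradiction (eq 0F) λ ()) , ≡.refl

    independent : Independent v
    independent a relation = λ { 0F → a₀≡0 ; 1F → a₁≡0 }
      where
      -- Coordinates 0 and 1 of the relation read `s + t` and `s - 2 t`; these combinations isolate
      -- `3 s` and `3 t`.
      combine₀ : ∀ s t → + 3 * s ≡ + 2 * (s * + 1 + (t * + 1 + 0ℤ)) + (s * + 1 + (t * - + 2 + 0ℤ))
      combine₀ = solve-∀
      combine₁ : ∀ s t → + 3 * t ≡ (s * + 1 + (t * + 1 + 0ℤ)) - (s * + 1 + (t * - + 2 + 0ℤ))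
      combine₁ = solve-∀
      cancel-3 : ∀ s → + 3 * s ≡ 0ℤ → s ≡ 0ℤ
      cancel-3 s 3s≡0 = [ (λ ()) , (λ s≡0 → s≡0) ]′ (ℤ.i*j≡0⇒i≡0∨j≡0 (+ 3) 3s≡0)
      a₀≡0 : a 0F ≡ 0ℤ
      a₀≡0 = cancel-3 (a 0F) (≡.trans (combine₀ (a 0F) (a 1F))
        (≡.cong₂ (λ s t → + 2 * s + t) (relation 0F) (relation 1F)))
      a₁≡0 : a 1F ≡ 0ℤ
      a₁≡0 = cancel-3 (a 1F) (≡.trans (combine₁ (a 0F) (a 1F))
        (≡.cong₂ _-_ (relation 0F) (relation 1F)))

  rank2-minDistSq : MinDistSq G 2 e (+ 6)
  rank2-minDistSq = minDistSq bound (_ , attained 0F)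

  rank2-wellRounded : WellRounded G 2 e
  rank2-wellRounded = wellRounded bound (v , attained , independent)

-- Case distinction by the rank of the lattice.

cyclic4-not-wellRounded : (G : AbelianGroup c ℓ) (e : Fin 4 → AbelianGroup.Carrier G) →
  IsListing G 3 e → IsoCyclic G 4 → ¬ WellRounded G 3 e
cyclic4-not-wellRounded G e listing iso (v , minimal , independent) =
  norm4-dependent iso v (proj₁ ∘ attained) (proj₂ ∘ proj₂ ∘ attained)
    (λ a relation → independent a (λ j → ≡.trans (∑ℤ≡sum 3 (λ k → a k * v k j)) (relation j)))
  where
  open Listing G 3 e listing
  open FiniteGroup G h h-injective h-surjective using (lattice-norm≥4; norm4-dependent)
  attained : ∀ k → Attains (+ 4) (v k)
  attained k = minimal⇒attained lattice-norm≥4 (norm4-attained ℕ.≤-refl) (v k) (minimal k)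

-- Pins `n` to a numeral, so that the results for a fixed small rank apply.
isoCyclic⇒rank : (G : AbelianGroup c ℓ) (n : ℕ) (e : Fin (suc n) → AbelianGroup.Carrier G) →
  IsListing G n e → IsoCyclic G (suc m) → n ≡ m
isoCyclic⇒rank G n e listing iso = ℕ.suc-injective (isoCyclic⇒order iso)
  where
  open Listing G n e listing
  open FiniteGroup G h h-injective h-surjective using (isoCyclic⇒order)

-- An element with nonzero double would make the group cyclic, so the group has exponent 2 and its
-- parallelogram vectors separate although there are only four elements.
rank3-wellRounded : (G : AbelianGroup c ℓ) (e : Fin 4 → AbelianGroup.Carrier G) →
  IsListing G 3 e → ¬ IsoCyclic G 4 → WellRounded G 3 e
rank3-wellRounded G e listing ¬cyclic = parallelograms-wellRounded
  (inj₂ (ℕ.n≤1+n 3 , λ a → decidable-stable (a ∙ a ≈? ε) (¬cyclic ∘ order4⇒isoCyclic ≡.refl a)))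
  where
  open AbelianGroup G using (_∙_; ε)
  open Listing G 3 e listing
  open FiniteGroup G h h-injective h-surjective using (_≈?_; order4⇒isoCyclic)

noncyclic4-wellRounded : (G : AbelianGroup c ℓ) (n : ℕ) (e : Fin (suc n) → AbelianGroup.Carrier G) →
  IsListing G n e → n ≥ 1 → ¬ IsoCyclic G 4 → WellRounded G n e
noncyclic4-wellRounded G 1 e listing _ _ = rank1-wellRounded G e listing
noncyclic4-wellRounded G 2 e listing _ _ = rank2-wellRounded G e listing
noncyclic4-wellRounded G 3 e listing _ ¬cyclic = rank3-wellRounded G e listing ¬cyclic
noncyclic4-wellRounded G n@(suc (suc (suc (suc k)))) e listing _ _ =
  Listing.parallelograms-wellRounded G n e listing (inj₁ (ℕ.m≤m+n 5 k))

generic-minDistSq : (G : AbelianGroup c ℓ) (n : ℕ) (e : Fin (suc n) → AbelianGroup.Carrier G) →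
  IsListing G n e → n ≥ 1 → ¬ IsoCyclic G 2 → ¬ IsoCyclic G 3 → MinDistSq G n e (+ 4)
generic-minDistSq G 1 e listing _ ¬cyclic2 _ = contradiction (order2⇒isoCyclic ≡.refl) ¬cyclic2
  where
  open Listing G 1 e listing
  open FiniteGroup G h h-injective h-surjective using (order2⇒isoCyclic)
generic-minDistSq G 2 e listing _ _ ¬cyclic3 = contradiction (order3⇒isoCyclic ≡.refl) ¬cyclic3
  where
  open Listing G 2 e listing
  open FiniteGroup G h h-injective h-surjective using (order3⇒isoCyclic)
generic-minDistSq G n@(suc (suc (suc k))) e listing _ _ _ =
  Listing.minDistSq≡4 G n e listing (ℕ.m≤m+n 4 k)

theorem1p2 : {c ℓ : Level} (G : AbelianGroup c ℓ) (n : ℕ) (e : Fin (suc n) → AbelianGroup.Carrier G) →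
    IsListing G n e → n ≥ 1 →
    (IsoCyclic G 4 → ¬ WellRounded G n e)
    × (¬ IsoCyclic G 4 → WellRounded G n e)
    × (IsoCyclic G 2 → MinDistSq G n e (+ 8))
    × (IsoCyclic G 3 → MinDistSq G n e (+ 6))
    × (¬ IsoCyclic G 1 → ¬ IsoCyclic G 2 → ¬ IsoCyclic G 3 → MinDistSq G n e (+ 4))
theorem1p2 G n e listing n≥1 =
    cyclic4
  , noncyclic4-wellRounded G n e listing n≥1
  , cyclic2
  , cyclic3
  , λ _ → generic-minDistSq G n e listing n≥1
  where
  cyclic4 : IsoCyclic G 4 → ¬ WellRounded G n e
  cyclic4 iso with ≡.refl ← isoCyclic⇒rank G n e listing iso = cyclic4-not-wellRounded G e listing iso
  cyclic2 : IsoCyclic G 2 → MinDistSq G n e (+ 8)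
  cyclic2 iso with ≡.refl ← isoCyclic⇒rank G n e listing iso = rank1-minDistSq G e listing
  cyclic3 : IsoCyclic G 3 → MinDistSq G n e (+ 6)
  cyclic3 iso with ≡.refl ← isoCyclic⇒rank G n e listing iso = rank2-minDistSq G e listing
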